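{- Let $C_n$ be the cycle graph on $n\ge 3$ vertices. Then \[ \mathrm{mpd}(C_n)=\begin{cases}\infty, & \text{if } n\le 7,\\ 5, & \text{if } n=8,\\ 4, & \text{if } n\ge 9.\end{cases} \]
   Context: $d(u,v)$ denotes the shortest-path distance. Let $G$ be a connected graph and let $\Pi=\{S_1,\dots,S_t\}$ be a partition of $V(G)$ into nonempty parts. For $v\in V(G)$ put $d(v,S_i)=\min\{d(v,x):x\in S_i\}$. The multiset partition representation of $v$ with respect to $\Pi$ is the multiset $r_{mp}(v\mid\Pi)=\{d(v,S_1),\dots,d(v,S_t)\}$ (order ignored, multiplicities kept). $\Pi$ is a resolving multiset partition if $r_{mp}(u\mid\Pi)\ne r_{mp}(v\mid\Pi)$ for all distinct $u,v\in V(G)$. The multiset partition dimension $\mathrm{mpd}(G)$ is the minimum number $t$ of parts of a resolving multiset partition of $G$, and $\mathrm{mpd}(G)=\infty$ if none exists. -}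

module Defs where

open import Data.Empty using (⊥-elim)
open import Data.Fin.Base using (Fin; zero; suc; toℕ; fromℕ<)
open import Data.Fin.Properties using (any?; toℕ<n; toℕ-fromℕ<; toℕ-injective)
  renaming (_≟_ to _≟ᶠ_)
open import Data.Fin.Subset using (Subset; Nonempty; _∈_)
open import Data.Fin.Subset.Properties using (_∈?_)
open import Data.List.Base using (List; tabulate)
open import Data.List.Relation.Binary.Permutation.Propositional using (_↭_)
open import Data.Nat.Base using (ℕ; zero; suc; _≤_; _<_; z≤n; s≤s)
open import Data.Nat.Properties
  using (_≟_; suc-injective; ≤-trans; ≤-antisym; 1+n≢n; n≤1+n)
open import Data.Product.Base using (Σ; ∃; _×_; _,_; proj₁; proj₂)
open import Data.Sum.Base using (_⊎_; inj₁; inj₂; swap)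
open import Relation.Binary.Definitions
  using (Decidable; Irreflexive; Symmetric)
open import Relation.Binary.PropositionalEquality
  using (_≡_; _≢_; refl; sym; trans; cong; subst)
open import Relation.Nullary using (¬_; Dec; yes; no)
open import Relation.Nullary.Construct.Add.Supremum using (_⁺; [_]; ⊤⁺)
open import Relation.Nullary.Decidable using (_×-dec_; _⊎-dec_; map′)
import Relation.Unary as U

IsLeast : (ℕ → Set) → ℕ → Set
IsLeast P k = P k × (∀ j → P j → k ≤ j)

least : {P : ℕ → Set} → U.Decidable P → ∃ P → ∃ (IsLeast P)
least {P} P? (k , pk) = search P? k pk
  where
  search : {Q : ℕ → Set} → U.Decidable Q → ∀ k → Q k → ∃ (IsLeast Q)
  search Q? zero q = zero , q , λ _ _ → z≤n
  search {Q} Q? (suc k) q with Q? zero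
  ... | yes q₀ = zero , q₀ , λ _ _ → z≤n
  ... | no ¬q₀ with search (λ j → Q? (suc j)) k q
  ...   | m , qm , m≤ = suc m , qm , λ where
            zero    q₀ → ⊥-elim (¬q₀ q₀)
            (suc j) qj → s≤s (m≤ j qj)

record Graph (n : ℕ) : Set₁ where
  field
    Adj        : Fin n → Fin n → Set
    adj?       : Decidable Adj
    adj-sym    : Symmetric Adj
    adj-irrefl : Irreflexive _≡_ Adj

module _ {n : ℕ} (G : Graph n) where
  open Graph G

  infixr 5 _▸_

  -- Walk k u v is the type of walks with k edges; a walk of least length
  -- is automatically a path.
  data Walk : ℕ → Fin n → Fin n → Set where
    nil : ∀ {u} → Walk 0 u u
    _▸_ : ∀ {k u v w} → Adj u v → Walk k v w → Walk (suc k) u w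

  Connected : Set
  Connected = ∀ u v → ∃ λ k → Walk k u v

  walk? : ∀ k u v → Dec (Walk k u v)
  walk? zero u v = map′ (λ { refl → nil }) (λ { nil → refl }) (u ≟ᶠ v)
  walk? (suc k) u w =
    map′ (λ { (_ , a , p) → a ▸ p }) (λ { (a ▸ p) → _ , a , p })
         (any? λ v → adj? u v ×-dec walk? k v w)

-- A set partition of the vertices: nonempty, pairwise disjoint parts that
-- cover.  The numbering of the parts plays no role in what follows.
record Partition (n t : ℕ) : Set where
  field
    part     : Fin t → Subset n
    nonempty : ∀ i → Nonempty (part i)
    disjoint : ∀ {i j v} → v ∈ part i → v ∈ part j → i ≡ j
    covers   : ∀ v → ∃ λ i → v ∈ part i

module _ {n : ℕ} (G : Graph n) (conn : Connected G) where

  d : Fin n → Fin n → ℕ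
  d u v = proj₁ (least (λ k → walk? G k u v) (conn u v))

  -- min { d v x : x ∈ S }
  dSet : Fin n → (S : Subset n) → Nonempty S → ℕ
  dSet v S (x₀ , x₀∈S) =
    proj₁ (least {λ k → ∃ λ x → x ∈ S × d v x ≡ k}
                 (λ k → any? λ x → (x ∈? S) ×-dec (d v x ≟ k))
                 (d v x₀ , x₀ , x₀∈S , refl))

  -- The list of entries; as a multiset it is this list up to _↭_.
  rmp : ∀ {t} → Partition n t → Fin n → List ℕ
  rmp Π v = tabulate λ i → dSet v (part i) (nonempty i)
    where open Partition Π

  Resolving : ∀ {t} → Partition n t → Set
  Resolving Π = ∀ u v → u ≢ v → ¬ (rmp Π u ↭ rmp Π v)

  HasResolving : ℕ → Set
  HasResolving t = Σ (Partition n t) Resolving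

  -- mpd(G) = m, for m in ℕ extended by a top element ⊤⁺ = ∞.
  IsMpd : ℕ ⁺ → Set
  IsMpd [ t ] = IsLeast HasResolving t
  IsMpd ⊤⁺    = ∀ t → ¬ HasResolving t

  IsMpd-unique : ∀ {a b} → IsMpd a → IsMpd b → a ≡ b
  IsMpd-unique {[ s ]} {[ t ]} (p , s≤) (q , t≤) =
    cong [_] (≤-antisym (s≤ t q) (t≤ s p))
  IsMpd-unique {[ s ]} {⊤⁺}    (p , _) none = ⊥-elim (none s p)
  IsMpd-unique {⊤⁺}    {[ t ]} none (q , _) = ⊥-elim (none t q)
  IsMpd-unique {⊤⁺}    {⊤⁺}    _ _ = refl

-- j = i + 1 modulo n
Next : ∀ {n} → Fin n → Fin n → Set
Next {n} i j = toℕ j ≡ suc (toℕ i) ⊎ (suc (toℕ i) ≡ n × toℕ j ≡ 0)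

next? : ∀ {n} → Decidable (Next {n})
next? {n} i j =
  (toℕ j ≟ suc (toℕ i)) ⊎-dec ((suc (toℕ i) ≟ n) ×-dec (toℕ j ≟ 0))

cycle : ∀ n → 3 ≤ n → Graph n
cycle n 3≤n = record
  { Adj        = λ i j → Next i j ⊎ Next j i
  ; adj?       = λ i j → next? i j ⊎-dec next? j i
  ; adj-sym    = swap
  ; adj-irrefl = λ { refl (inj₁ e) → noLoop 3≤n e ; refl (inj₂ e) → noLoop 3≤n e }
  }
  where
  noLoop : ∀ {n} {i : Fin n} → 3 ≤ n → ¬ Next i i
  noLoop 3≤n (inj₁ e) = 1+n≢n (sym e)
  noLoop (s≤s (s≤s _)) (inj₂ (e , e₀)) with trans (sym e) (cong suc e₀)
  ... | ()

cycle-connected : ∀ n (3≤n : 3 ≤ n) → Connected (cycle n 3≤n)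
cycle-connected n@(suc _) 3≤n u v = join (reverse (fromZero u)) (fromZero v)
  where
  W : ℕ → Fin n → Fin n → Set
  W = Walk (cycle n 3≤n)

  join : ∀ {a b c} → ∃ (λ k → W k a b) → ∃ (λ k → W k b c) → ∃ (λ k → W k a c)
  join (_ , nil)    q = q
  join (_ , e ▸ p) q with join (_ , p) q
  ... | _ , r = _ , e ▸ r

  reverse : ∀ {a b} → ∃ (λ k → W k a b) → ∃ (λ k → W k b a)
  reverse (_ , nil)    = _ , nil
  reverse (_ , e ▸ p) = join (reverse (_ , p)) (_ , swap e ▸ nil)

  go : ∀ m (m<n : m < n) → ∃ λ k → W k zero (fromℕ< m<n)
  go zero    (s≤s _) = _ , nil
  go (suc m) m+1<n =
    join (go m m<n)
         (_ , inj₁ (inj₁ (trans (toℕ-fromℕ< m+1<n)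
                                (cong suc (sym (toℕ-fromℕ< m<n))))) ▸ nil)
    where m<n = ≤-trans (n≤1+n _) m+1<n

  fromZero : ∀ w → ∃ λ k → W k zero w
  fromZero w = subst (λ x → ∃ λ k → W k zero x)
                     (toℕ-injective (toℕ-fromℕ< (toℕ<n w)))
                     (go (toℕ w) (toℕ<n w))

{-# OPTIONS --safe #-}
module Submission where

-- A function h on the vertices of a connected graph is the distance to its
-- zero set iff |h u - h v| ≤ 1 along edges and every vertex with h > 0 has a
-- neighbour where h is one smaller.  Distances to parts are handled only
-- through this local criterion.
--
-- Three parts never resolve.  Take a vertex v of Z next to X, at distance x
-- from Y, with x minimal over all such situations.  If x ≥ 2, walk x - 1 steps
-- from v towards Y: the vertex reached lies next to Y, and either it has the
-- same representation {0, 1, x} as v or it contradicts minimality.  If x = 1,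
-- then v and its neighbours in X and Y all have representation {0, 1, 1} or
-- {0, 1, 2}, so two of them coincide.
--
-- For n ≤ 7, and for n = 8 with four parts, all set partitions are searched;
-- for 8 ≤ n ≤ 10 a resolving partition is given by its table of distances.
-- For n ≥ 11 take two adjacent singletons A and B, and let C be an arc of
-- three (n odd) or four (n even) vertices opposite to them, placed so that the
-- arc from A to C avoiding B is two edges shorter than the arc from B to C
-- avoiding A; D is the rest.  Then no two representations have both the same
-- sum and the same sum of squares.

open import Defs
open import Data.Bool.Base using (T)
open import Data.Empty using (⊥; ⊥-elim)
open import Data.Fin.Base using (Fin; zero; suc; toℕ; fromℕ<; inject₁)
open import Data.Fin.Properties using (all?; any?; toℕ<n; toℕ-fromℕ<; toℕ-inject₁)
  renaming (_≟_ to _≟ᶠ_)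
open import Data.Fin.Subset using (Subset; Nonempty; _∈_)
open import Data.Fin.Subset.Properties using (_∈?_)
open import Data.List.Base
  using (List; []; _∷_; _++_; map; tabulate; allFin; filter; foldr; length; lookup)
open import Data.List.Membership.Propositional using (find) renaming (_∈_ to _∈ᴸ_)
open import Data.List.Membership.Propositional.Properties
  using (∈-allFin; ∈-map⁺; ∈-map⁻; ∈-filter⁺; ∈-filter⁻; ∈-lookup; foldr-selective)
open import Data.List.Membership.Propositional.Properties.WithK using (unique∧set⇒bag)
open import Data.List.Properties
  using (map-∘; map-tabulate; tabulate-cong; map-cong-local; length-map; length-tabulate;
         length-++; foldr-preservesᵒ)
  renaming (≡-dec to ≡-decᴸ)
open import Data.List.Relation.Binary.BagAndSetEquality using (∼bag⇒↭)
open import Data.List.Relation.Binary.Permutation.Propositional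
  using (_↭_; ↭-sym; ↭-trans; ↭-reflexive; ↭-swap; ↭-refl)
open import Data.List.Relation.Binary.Permutation.Propositional.Properties
  using (map⁺; ↭-length)
open import Data.List.Relation.Unary.All as All using (All; []; _∷_)
import Data.List.Relation.Unary.All.Properties as All
open import Data.List.Relation.Unary.AllPairs as AllPairs using (AllPairs; []; _∷_; allPairs?)
import Data.List.Relation.Unary.AllPairs.Properties as AllPairs
open import Data.List.Relation.Unary.Any as Any using (here; there)
open import Data.List.Relation.Unary.Unique.Propositional using (Unique)
open import Data.List.Relation.Unary.Unique.Propositional.Properties using (allFin⁺)
  renaming (map⁺ to unique-map⁺)
open import Data.List.Sort.Base using (module SortingAlgorithm)
open import Data.Nat.Base
open import Data.Nat.Induction using (Acc; acc; <-wellFounded)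
open import Data.Nat.ListAction using (sum)
open import Data.Nat.ListAction.Properties using (sum-↭)
open import Data.Nat.Properties
open import Data.Nat.Tactic.RingSolver using (solve-∀)
open import Data.Product.Base using (∃; ∃₂; _×_; _,_; proj₁; proj₂)
open import Data.Product.Properties using (≡-dec)
open import Data.Sum.Base using (_⊎_; inj₁; inj₂)
open import Data.Unit.Base using (⊤; tt)
open import Data.Vec.Base as Vec using (Vec; []; _∷_)
open import Data.Vec.Properties using (lookup⇒[]=; []=⇒lookup; lookup∘tabulate)
open import Function.Base using (_∘_)
open import Function.Bundles using (mk⇔)
open import Relation.Binary.PropositionalEquality
open import Relation.Nullary using (¬_; Dec; yes; no; does)
open import Relation.Nullary.Construct.Add.Supremum using ([_]; ⊤⁺)
open import Relation.Nullary.Decidable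
  using (True; toWitness; dec-true; ¬?; _×-dec_; _⊎-dec_; _→-dec_)
open import Relation.Unary using (Decidable)
open import Relation.Unary.Properties using (U?)

open import Data.List.Relation.Unary.Unique.DecPropositional (≡-decᴸ _≟_) using (unique?)
open import Data.List.Sort.InsertionSort ≤-decTotalOrder using (insertionSort)
open SortingAlgorithm insertionSort using (sort; sort-↭)

-- Distances to parts, and the lower bound of four parts

-- Two duplicate-free index lists with the same members are permutations of each other. This frees
-- `rmp` from the numbering of the parts.
tabulate-↭ : ∀ {t} {A : Set} (f : Fin t → A) {is} →
             Unique is → (∀ i → i ∈ᴸ is) → tabulate f ↭ map f is
tabulate-↭ {t} f is! all∈ = ↭-trans
  (↭-reflexive (sym (map-tabulate (λ i → i) f)))
  (map⁺ f (∼bag⇒↭ (unique∧set⇒bag (allFin⁺ t) is! (mk⇔ (λ _ → all∈ _) (λ _ → ∈-allFin _)))))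

Distinct₃ : ∀ {t} → Fin t → Fin t → Fin t → Set
Distinct₃ i j k = i ≢ j × i ≢ k × j ≢ k

exhaust₃ : (i j k : Fin 3) → Distinct₃ i j k → ∀ l → l ≡ i ⊎ l ≡ j ⊎ l ≡ k
exhaust₃ = toWitness {a? = all? λ i → all? λ j → all? λ k →
  (¬? (i ≟ᶠ j) ×-dec ¬? (i ≟ᶠ k) ×-dec ¬? (j ≟ᶠ k)) →-dec
  all? λ l → (l ≟ᶠ i) ⊎-dec (l ≟ᶠ j) ⊎-dec (l ≟ᶠ k)} tt

tabulate₃-↭ : ∀ {A : Set} (f : Fin 3 → A) {i j k} → Distinct₃ i j k →
              tabulate f ↭ f i ∷ f j ∷ f k ∷ []
tabulate₃-↭ f {i} {j} {k} ijk@(i≢j , i≢k , j≢k) =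
  tabulate-↭ f ((i≢j ∷ i≢k ∷ []) ∷ (j≢k ∷ []) ∷ [] ∷ []) mem
  where
  mem : ∀ l → l ∈ᴸ i ∷ j ∷ k ∷ []
  mem l with exhaust₃ i j k ijk l
  ... | inj₁ eq        = here eq
  ... | inj₂ (inj₁ eq) = there (here eq)
  ... | inj₂ (inj₂ eq) = there (there (here eq))

module _ {n} (G : Graph n) where
  open Graph G

  Local : (Fin n → ℕ) → Set
  Local h = ∀ v → (∀ w → Adj v w → h v ≤ suc (h w))
                × (h v ≡ 0 ⊎ ∃ λ w → Adj v w × h v ≡ suc (h w))

  local? : ∀ h → Dec (Local h)
  local? h = all? λ v → all? (λ w → adj? v w →-dec (h v ≤? suc (h w)))
                  ×-dec ((h v ≟ 0) ⊎-dec any? λ w → adj? v w ×-dec (h v ≟ suc (h w)))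

  module _ {h} (loc : Local h) where

    local-backward : ∀ {k u v} → Walk G k u v → h u ≤ k + h v
    local-backward nil     = ≤-refl
    local-backward (a ▸ p) = ≤-trans (proj₁ (loc _) _ a) (s≤s (local-backward p))

    local-forward : ∀ {k u v} → Walk G k u v → h v ≤ k + h u
    local-forward nil             = ≤-refl
    local-forward (_▸_ {k} {u} a p) = ≤-trans (local-forward p) (≤-trans
      (+-monoʳ-≤ k (proj₁ (loc _) _ (adj-sym a))) (≤-reflexive (+-suc k (h u))))

    local-pred : ∀ {v k} → h v ≡ suc k → ∃ λ w → Adj v w × h w ≡ k
    local-pred {v} eq with proj₂ (loc v)
    ... | inj₁ eq₀           = ⊥-elim (0≢1+n (trans (sym eq₀) eq))
    ... | inj₂ (w , a , eq′) = w , a , suc-injective (trans (sym eq′) eq)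

    -- A positive `r` lets the walk stop short of the zero set; `r = 1` gives a vertex bordering on
    -- it.
    local-descent : ∀ m {r v} → h v ≡ m + r → ∃ λ w → Walk G m v w × h w ≡ r
    local-descent zero    eq = _ , nil , eq
    local-descent (suc m) eq with local-pred eq
    ... | u , a , eq′ with local-descent m eq′
    ...   | w , p , eq″ = w , a ▸ p , eq″

    local-zero : ∀ v → ∃ λ w → Walk G (h v) v w × h w ≡ 0
    local-zero v = local-descent (h v) (sym (+-identityʳ (h v)))

  module _ (conn : Connected G) where

    d-walk : ∀ u v → Walk G (d G conn u v) u v
    d-walk u v = proj₁ (proj₂ (least (λ k → walk? G k u v) (conn u v)))

    d-minimal : ∀ {k u v} → Walk G k u v → d G conn u v ≤ k
    d-minimal {k} {u} {v} = proj₂ (proj₂ (least (λ k → walk? G k u v) (conn u v))) k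

    module _ (S : Subset n) (ne : Nonempty S) where

      private
        D : Fin n → ℕ
        D v = dSet G conn v S ne

        isLeast : ∀ v → IsLeast (λ k → ∃ λ x → x ∈ S × d G conn v x ≡ k) (D v)
        isLeast v = proj₂ (least {λ k → ∃ λ x → x ∈ S × d G conn v x ≡ k}
          (λ k → any? λ x → (x ∈? S) ×-dec (d G conn v x ≟ k))
          (d G conn v (proj₁ ne) , proj₁ ne , proj₂ ne , refl))

      dSet-attained : ∀ v → ∃ λ x → x ∈ S × d G conn v x ≡ D v
      dSet-attained v = proj₁ (isLeast v)

      dSet-minimal : ∀ {v x} → x ∈ S → D v ≤ d G conn v x
      dSet-minimal x∈S = proj₂ (isLeast _) _ (_ , x∈S , refl)

      dSet-≤ : ∀ {k v x} → x ∈ S → Walk G k v x → D v ≤ k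
      dSet-≤ x∈S p = ≤-trans (dSet-minimal x∈S) (d-minimal p)

      dSet-walk : ∀ v → ∃ λ x → x ∈ S × Walk G (D v) v x
      dSet-walk v with dSet-attained v
      ... | x , x∈S , eq = x , x∈S , subst (λ k → Walk G k v x) eq (d-walk v x)

      dSet≡0⇒∈ : ∀ {v} → D v ≡ 0 → v ∈ S
      dSet≡0⇒∈ {v} eq with dSet-walk v
      ... | x , x∈S , p with D v | eq | p
      ...   | _ | refl | nil = x∈S

      ∈⇒dSet≡0 : ∀ {v} → v ∈ S → D v ≡ 0
      ∈⇒dSet≡0 v∈S = n≤0⇒n≡0 (dSet-≤ v∈S nil)

      dSet-local : Local D
      dSet-local v = lipschitz , descent
        where
        lipschitz : ∀ w → Adj v w → D v ≤ suc (D w)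
        lipschitz w a with dSet-walk w
        ... | x , x∈S , p = dSet-≤ x∈S (a ▸ p)
        descent : D v ≡ 0 ⊎ ∃ λ w → Adj v w × D v ≡ suc (D w)
        descent with dSet-walk v
        ... | x , x∈S , p = go refl p
          where
          -- The length is generalised to a variable `k` so that the walk can be matched on.
          go : ∀ {k} → D v ≡ k → Walk G k v x → D v ≡ 0 ⊎ ∃ λ w → Adj v w × D v ≡ suc (D w)
          go eq nil     = inj₁ eq
          go eq (a ▸ q) = inj₂ (_ , a , ≤-antisym (lipschitz _ a)
            (≤-trans (s≤s (dSet-≤ x∈S q)) (≤-reflexive (sym eq))))

      -- Descending along `h` reaches `S` in `h v` steps, so `D v ≤ h v`. Along a shortest walk to
      -- `S` the value of `h` drops by at most one per edge, so `h v ≤ D v`.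
      local⇒dSet : ∀ {h} → Local h → (∀ {v} → v ∈ S → h v ≡ 0) → (∀ {v} → h v ≡ 0 → v ∈ S) →
                   ∀ v → D v ≡ h v
      local⇒dSet {h} loc ∈⇒0 0⇒∈ v = ≤-antisym D≤h h≤D
        where
        D≤h : D v ≤ h v
        D≤h with local-zero loc v
        ... | x , p , eq = dSet-≤ (0⇒∈ eq) p
        h≤D : h v ≤ D v
        h≤D with dSet-walk v
        ... | x , x∈S , p = ≤-trans (local-backward loc p)
          (≤-reflexive (trans (cong (D v +_) (∈⇒0 x∈S)) (+-identityʳ (D v))))

    module Distances {t} (Π : Partition n t) where
      open Partition Π

      D : Fin t → Fin n → ℕ
      D i v = dSet G conn v (part i) (nonempty i)

      D-local : ∀ i → Local (D i)
      D-local i = dSet-local (part i) (nonempty i)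

      D-disjoint : ∀ {i j v} → D i v ≡ 0 → D j v ≡ 0 → i ≡ j
      D-disjoint p q = disjoint (dSet≡0⇒∈ _ _ p) (dSet≡0⇒∈ _ _ q)

      D-covers : ∀ v → ∃ λ i → D i v ≡ 0
      D-covers v = proj₁ (covers v) , ∈⇒dSet≡0 _ _ (proj₂ (covers v))

      D-step : ∀ {i v w x} → Adj v w → D i v ≡ x → D i w ≤ suc x
      D-step {i} {v} {w} a refl = proj₁ (D-local i w) v (adj-sym a)

      D≡1 : ∀ {i j v} → i ≢ j → D i v ≡ 0 → D j v ≤ 1 → D j v ≡ 1
      D≡1 {i} {j} {v} i≢j p ≤1 with D j v in eq | ≤1
      ... | 0 | _ = ⊥-elim (i≢j (D-disjoint p eq))
      ... | 1 | _ = refl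
      ... | suc (suc _) | s≤s ()

    -- A partition given by its distance functions: the parts are their zero sets, and the
    -- representations can be read from the table.
    record Labelling (t : ℕ) : Set where
      field
        label    : Fin t → Fin n → ℕ
        local    : ∀ i → Local (label i)
        disjoint : ∀ i j v → label i v ≡ 0 → label j v ≡ 0 → i ≡ j
        covers   : ∀ v → ∃ λ i → label i v ≡ 0

      part : Fin t → Subset n
      part i = Vec.tabulate λ v → does (label i v ≟ 0)

      ∈-part⁺ : ∀ {i v} → label i v ≡ 0 → v ∈ part i
      ∈-part⁺ {i} {v} eq = lookup⇒[]= v (part i)
        (trans (lookup∘tabulate _ v) (dec-true (label i v ≟ 0) eq))

      ∈-part⁻ : ∀ {i v} → v ∈ part i → label i v ≡ 0
      -- `does (label i v ≟ 0)` computes to `label i v ≡ᵇ 0`, hence `≡ᵇ⇒≡`.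
      ∈-part⁻ {i} {v} v∈ = ≡ᵇ⇒≡ (label i v) 0 (subst T
        (trans (sym ([]=⇒lookup v∈)) (lookup∘tabulate _ v)) tt)

      partition : Fin n → Partition n t
      partition v = record
        { part     = part
        -- Descent from any one vertex ends inside every part.
        ; nonempty = λ i → let x , _ , eq = local-zero (local i) v in x , ∈-part⁺ eq
        ; disjoint = λ {i} {j} p q → disjoint i j _ (∈-part⁻ p) (∈-part⁻ q)
        ; covers   = λ v → proj₁ (covers v) , ∈-part⁺ (proj₂ (covers v))
        }

      hasResolving : Fin n →
        (∀ u v → u ≢ v → ¬ (tabulate (λ i → label i u) ↭ tabulate (λ i → label i v))) →
        HasResolving G conn t
      hasResolving v₀ distinct = partition v₀ , λ u v u≢v p → distinct u v u≢v
        (subst₂ _↭_ (rmp≡ u) (rmp≡ v) p)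
        where
        rmp≡ : ∀ v → rmp G conn (partition v₀) v ≡ tabulate (λ i → label i v)
        rmp≡ v = tabulate-cong λ i → local⇒dSet _ _ (local i) ∈-part⁻ ∈-part⁺ v

    ¬resolving₀ : Fin n → ¬ HasResolving G conn 0
    ¬resolving₀ v (Π , _) with Partition.covers Π v
    ... | () , _

    ¬resolving₁ : ∀ {u v : Fin n} → u ≢ v → ¬ HasResolving G conn 1
    ¬resolving₁ {u} {v} u≢v (Π , res) =
      res u v u≢v (↭-reflexive (cong (_∷ []) (trans (D≡0 u) (sym (D≡0 v)))))
      where
      open Distances Π
      D≡0 : ∀ v → D zero v ≡ 0
      D≡0 v with D-covers v
      ... | zero , eq = eq

    -- An edge joining the two parts has both ends represented by {0, 1}.
    ¬resolving₂ : ¬ HasResolving G conn 2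
    ¬resolving₂ (Π , res) = crossing (D (suc zero) u) refl
      where
      open Distances Π
      u  = proj₁ (Partition.nonempty Π zero)
      u∈ = proj₂ (Partition.nonempty Π zero)
      crossing : ∀ k → D (suc zero) u ≡ k → ⊥
      crossing zero    eq with D-disjoint {zero} {suc zero} (∈⇒dSet≡0 _ _ u∈) eq
      ... | ()
      crossing (suc k) eq with local-descent (D-local (suc zero)) k (trans eq (+-comm 1 k))
      ... | v , _ , Dv≡1 with local-pred (D-local (suc zero)) Dv≡1
      ...   | w , a , Dw≡0 = res v w v≢w (subst₂ _↭_
                (cong₂ (λ x y → x ∷ y ∷ []) (sym D₀v≡0) (sym Dv≡1))
                (cong₂ (λ x y → x ∷ y ∷ []) (sym D₀w≡1) (sym Dw≡0))
                (↭-swap 0 1 ↭-refl))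
        where
        v≢w : v ≢ w
        v≢w v≡w with trans (sym Dv≡1) (trans (cong (D (suc zero)) v≡w) Dw≡0)
        ... | ()
        D₀v≡0 : D zero v ≡ 0
        D₀v≡0 with D-covers v
        ... | zero     , eq = eq
        ... | suc zero , eq = ⊥-elim (0≢1+n (trans (sym eq) Dv≡1))
        D₀w≡1 : D zero w ≡ 1
        D₀w≡1 = D≡1 (λ ()) Dw≡0 (D-step a D₀v≡0)

    ¬resolving₃ : ¬ HasResolving G conn 3
    ¬resolving₃ (Π , res) = start (D (suc zero) u) refl
      where
      open Distances Π
      u  = proj₁ (Partition.nonempty Π zero)
      u∈ = proj₂ (Partition.nonempty Π zero)

      collision : ∀ {u v i j k i′ j′ k′} → Distinct₃ i j k → Distinct₃ i′ j′ k′ → u ≢ v →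
                  D i u ≡ D i′ v → D j u ≡ D j′ v → D k u ≡ D k′ v → ⊥
      collision {u} {v} ijk ijk′ u≢v p q r = res u v u≢v
        (↭-trans (tabulate₃-↭ (λ i → D i u) ijk)
        (↭-trans (↭-reflexive (cong₂ _∷_ p (cong₂ _∷_ q (cong (_∷ []) r))))
        (↭-sym (tabulate₃-↭ (λ i → D i v) ijk′))))

      distinct : ∀ i {u v x y} → x ≢ y → D i u ≡ x → D i v ≡ y → u ≢ v
      distinct i x≢y p q refl = x≢y (trans (sym p) q)

      1or2 : ∀ {i j v} → i ≢ j → D i v ≡ 0 → D j v ≤ 2 → D j v ≡ 1 ⊎ D j v ≡ 2
      1or2 {i} {j} {v} i≢j p ≤2 with D j v in eq | ≤2
      ... | 0 | _ = ⊥-elim (i≢j (D-disjoint p eq))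
      ... | 1 | _ = inj₁ refl
      ... | 2 | _ = inj₂ refl
      ... | suc (suc (suc _)) | s≤s (s≤s ())

      -- Here `i`, `j`, `k` are the parts Z, X, Y of the opening sketch, and well-founded induction
      -- on `x` takes the place of the minimal choice.
      boundary : ∀ x → Acc _<_ x → ∀ v i j k → Distinct₃ i j k →
                 D i v ≡ 0 → D j v ≡ 1 → D k v ≡ x → ⊥
      boundary 0 _ v i j k (_ , i≢k , _) p q r = i≢k (D-disjoint p r)
      boundary 1 _ v i j k ijk@(i≢j , i≢k , j≢k) p q r
        with local-pred (D-local j) q | local-pred (D-local k) r
      ... | w , a , Djw | z , b , Dkz = cases
        (1or2 j≢k Djw (D-step a r)) (1or2 (j≢k ∘ sym) Dkz (D-step b q))
        where
        Diw : D i w ≡ 1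
        Diw = D≡1 (i≢j ∘ sym) Djw (D-step a p)
        Diz : D i z ≡ 1
        Diz = D≡1 (i≢k ∘ sym) Dkz (D-step b p)
        -- If `w` or `z` is at distance 1 from the third part, it shares {0, 1, 1} with `v`;
        -- otherwise `w` and `z` share {0, 1, 2}.
        cases : D k w ≡ 1 ⊎ D k w ≡ 2 → D j z ≡ 1 ⊎ D j z ≡ 2 → ⊥
        cases (inj₁ Dkw) _ = collision ijk (i≢j ∘ sym , j≢k , i≢k)
          (distinct j (λ ()) q Djw) (trans p (sym Djw)) (trans q (sym Diw)) (trans r (sym Dkw))
        cases (inj₂ _) (inj₁ Djz) = collision ijk (j≢k ∘ sym , i≢k ∘ sym , i≢j ∘ sym)
          (distinct k (λ ()) r Dkz) (trans p (sym Dkz)) (trans q (sym Djz)) (trans r (sym Diz))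
        cases (inj₂ Dkw) (inj₂ Djz) =
          collision (i≢j ∘ sym , j≢k , i≢k) (i≢k ∘ sym , j≢k ∘ sym , i≢j)
          (distinct j (λ ()) Djw Djz) (trans Djw (sym Dkz)) (trans Diw (sym Diz)) (trans Dkw (sym Djz))
      boundary (suc (suc y)) (acc rs) v i j k ijk@(i≢j , i≢k , j≢k) p q r
        with local-descent (D-local k) (suc y) (trans r (+-comm 1 (suc y)))
      ... | w , path , Dkw with D-covers w
      ...   | l , Dlw with exhaust₃ i j k ijk l
      ...     | inj₂ (inj₂ refl) = 0≢1+n (trans (sym Dlw) Dkw)
      -- `w` lies in X next to Y, and the `suc y` steps from `v` keep it closer than `x` to Z:
      -- induct with the roles rotated.
      ...     | inj₂ (inj₁ refl) = boundary (D i w) (rs (s≤s Diw≤)) w j k i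
                  (j≢k , i≢j ∘ sym , i≢k ∘ sym) Dlw Dkw refl
        where
        Diw≤ : D i w ≤ suc y
        Diw≤ = ≤-trans (local-forward (D-local i) path)
          (≤-reflexive (trans (cong (suc y +_) p) (+-identityʳ (suc y))))
      -- `w` lies in Z next to Y, at distance at most `x` from X. If the distance is smaller, induct
      -- with X and Y exchanged; if it equals `x`, then `v` and `w` share {0, 1, x} and differ in
      -- their distance to Y.
      ...     | inj₁ refl with m≤n⇒m<n∨m≡n Djw≤
        where
        Djw≤ : D j w ≤ suc (suc y)
        Djw≤ = ≤-trans (local-forward (D-local j) path)
          (≤-reflexive (trans (cong (suc y +_) q) (+-comm (suc y) 1)))
      ...       | inj₁ Djw< = boundary (D j w) (rs Djw<) w i k j (i≢k , i≢j , j≢k ∘ sym) Dlw Dkw refl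
      ...       | inj₂ Djw≡ = collision ijk (i≢k , i≢j , j≢k ∘ sym)
                  (distinct k (λ ()) r Dkw) (trans p (sym Dlw)) (trans q (sym Dkw)) (trans r (sym Djw≡))

      start : ∀ x → D (suc zero) u ≡ x → ⊥
      start zero eq with D-disjoint {zero} {suc zero} (∈⇒dSet≡0 _ _ u∈) eq
      ... | ()
      start (suc x) eq with local-descent (D-local (suc zero)) x (trans eq (+-comm 1 x))
      ... | v , _ , D₁v with D-covers v
      ...   | zero , D₀v = boundary _ (<-wellFounded _) v zero (suc zero) (suc (suc zero))
                ((λ ()) , (λ ()) , (λ ())) D₀v D₁v refl
      ...   | suc zero , D₁v′ = 0≢1+n (trans (sym D₁v′) D₁v)
      ...   | suc (suc zero) , D₂v = boundary _ (<-wellFounded _) v (suc (suc zero)) (suc zero) zero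
                ((λ ()) , (λ ()) , (λ ())) D₂v D₁v refl

-- Exhaustive search over set partitions

-- The base value `f x` makes the empty list harmless. In `profile`, `x` is the representative of
-- the class, so it does not disturb the minimum.
minimum : ∀ {A : Set} → (A → ℕ) → A → List A → ℕ
minimum f x xs = foldr _⊓_ (f x) (map f xs)

minimum-≤ : ∀ {A : Set} (f : A → ℕ) {x y} {xs : List A} → y ∈ᴸ xs → minimum f x xs ≤ f y
minimum-≤ f {x} {y} {xs} y∈ = foldr-preservesᵒ ≤-pres (f x) (map f xs)
  (inj₂ (Any.map (λ eq → ≤-reflexive (sym eq)) (∈-map⁺ f y∈)))
  where
  ≤-pres : ∀ a b → a ≤ f y ⊎ b ≤ f y → a ⊓ b ≤ f y
  ≤-pres a b (inj₁ p) = ≤-trans (m⊓n≤m a b) p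
  ≤-pres a b (inj₂ p) = ≤-trans (m⊓n≤n a b) p

minimum-attained : ∀ {A : Set} (f : A → ℕ) x (xs : List A) →
                   ∃ λ y → y ∈ᴸ x ∷ xs × minimum f x xs ≡ f y
minimum-attained f x xs with foldr-selective ⊓-sel (f x) (map f xs)
... | inj₁ eq = x , here refl , eq
... | inj₂ m∈ with ∈-map⁻ f m∈
...   | y , y∈ , eq = y , there y∈ , eq

unique-map⁻-injective : ∀ {A B : Set} (f : A → B) {xs x y} → Unique (map f xs) →
                        x ∈ᴸ xs → y ∈ᴸ xs → f x ≡ f y → x ≡ y
unique-map⁻-injective f (_ ∷ _)   (here refl) (here refl) eq = refl
unique-map⁻-injective f (fx∉ ∷ _) (here refl) (there y∈)  eq = ⊥-elim (All.lookup fx∉ (∈-map⁺ f y∈) eq)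
unique-map⁻-injective f (fy∉ ∷ _) (there x∈)  (here refl) eq = ⊥-elim (All.lookup fy∉ (∈-map⁺ f x∈) (sym eq))
unique-map⁻-injective f (_ ∷ u)   (there x∈)  (there y∈)  eq = unique-map⁻-injective f u x∈ y∈ eq

-- The search computes with a numerical `δ`, equated with `d` only in the correctness proof, so
-- deciding it never evaluates `d`. `P` selects the numbers of parts to be refuted.
module Search {n} (δ : Fin n → Fin n → ℕ) {P : ℕ → Set} (P? : Decidable P) where

  Assignment : Set
  Assignment = List (Fin n × Fin n)

  class : Assignment → Fin n → List (Fin n)
  class p a = map proj₁ (filter (λ xb → proj₂ xb ≟ᶠ a) p)

  profile : List (Fin n) → Assignment → Fin n → List ℕ
  profile reps p v = map (λ a → minimum (δ v) a (class p a)) reps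

  -- reps holds the first vertex met in each part, which names the part.
  Exhausted : List (Fin n) → Assignment → List (Fin n) → Set
  Exhausted reps p []       = P (length reps) → ¬ Unique (map (sort ∘ profile reps p) (allFin n))
  Exhausted reps p (x ∷ vs) = Exhausted (x ∷ reps) ((x , x) ∷ p) vs
                            × All (λ a → Exhausted reps ((x , a) ∷ p) vs) reps

  exhausted? : ∀ reps p vs → Dec (Exhausted reps p vs)
  exhausted? reps p []       = P? (length reps) →-dec ¬? (unique? (map (sort ∘ profile reps p) (allFin n)))
  exhausted? reps p (x ∷ vs) = exhausted? (x ∷ reps) ((x , x) ∷ p) vs
                         ×-dec All.all? (λ a → exhausted? reps ((x , a) ∷ p) vs) reps

  module _ (G : Graph n) (conn : Connected G) (d≡δ : ∀ u v → d G conn u v ≡ δ u v)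
           {t} (Π : Partition n t) where
    open Partition Π

    private
      colour : Fin n → Fin t
      colour v = proj₁ (covers v)

      colour⁺ : ∀ {v i} → v ∈ part i → colour v ≡ i
      colour⁺ = disjoint (proj₂ (covers _))

      colour⁻ : ∀ {v i} → colour v ≡ i → v ∈ part i
      colour⁻ refl = proj₂ (covers _)

    -- The invariant along the one branch of the search tree that mirrors `Π`.
    record Consistent (reps : List (Fin n)) (p : Assignment) : Set where
      field
        reps!    : Unique (map colour reps)
        coloured : All (λ ((x , a) : Fin n × Fin n) → colour x ≡ colour a × a ∈ᴸ reps) p

    module _ {reps p} (cons : Consistent reps p) (total : ∀ x → x ∈ᴸ map proj₁ p) where
      open Consistent cons

      assigned : ∀ x → ∃ λ a → (x , a) ∈ᴸ p × colour x ≡ colour a × a ∈ᴸ reps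
      assigned x with ∈-map⁻ proj₁ (total x)
      ... | (_ , a) , xa∈ , refl = a , xa∈ , All.lookup coloured xa∈

      ∈-class⁺ : ∀ {x a} → a ∈ᴸ reps → colour x ≡ colour a → x ∈ᴸ class p a
      ∈-class⁺ {x} {a} a∈ eq with assigned x
      ... | b , xb∈ , eq′ , b∈
        with refl ← unique-map⁻-injective colour reps! b∈ a∈ (trans (sym eq′) eq)
        = ∈-map⁺ proj₁ (∈-filter⁺ _ xb∈ refl)

      ∈-class⁻ : ∀ {x a} → x ∈ᴸ class p a → colour x ≡ colour a
      ∈-class⁻ {x} {a} x∈ with ∈-map⁻ proj₁ x∈
      ... | (_ , b) , xb∈ , refl with ∈-filter⁻ (λ xb → proj₂ xb ≟ᶠ a) {xs = p} xb∈
      ...   | xb∈p , refl = proj₁ (All.lookup coloured xb∈p)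

      -- Once every vertex is assigned, the class of a representative is exactly its part.
      dSet≡minimum : ∀ v {a} → a ∈ᴸ reps →
        dSet G conn v (part (colour a)) (nonempty (colour a)) ≡ minimum (δ v) a (class p a)
      dSet≡minimum v {a} a∈ = ≤-antisym D≤m m≤D
        where
        D≤m : dSet G conn v (part (colour a)) (nonempty (colour a)) ≤ minimum (δ v) a (class p a)
        D≤m with minimum-attained (δ v) a (class p a)
        ... | y , y∈ , eq = ≤-trans
          (dSet-minimal G conn _ _ (colour⁻ (same y∈)))
          (≤-reflexive (trans (d≡δ v y) (sym eq)))
          where
          same : y ∈ᴸ a ∷ class p a → colour y ≡ colour a
          same (here eq)  = cong colour eq
          same (there y∈) = ∈-class⁻ y∈
        m≤D : minimum (δ v) a (class p a) ≤ dSet G conn v (part (colour a)) (nonempty (colour a))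
        m≤D with dSet-attained G conn (part (colour a)) (nonempty (colour a)) v
        ... | y , y∈ , eq = ≤-trans (minimum-≤ (δ v) (∈-class⁺ a∈ (colour⁺ y∈)))
          (≤-reflexive (trans (sym (d≡δ v y)) eq))

      reps-cover : ∀ i → i ∈ᴸ map colour reps
      reps-cover i with nonempty i
      ... | x , x∈ with assigned x
      ...   | a , _ , eq , a∈ = subst (_∈ᴸ map colour reps) (trans (sym eq) (colour⁺ x∈)) (∈-map⁺ colour a∈)

      rmp↭profile : ∀ v → rmp G conn Π v ↭ profile reps p v
      rmp↭profile v = ↭-trans (tabulate-↭ _ reps! reps-cover) (↭-reflexive
        (trans (sym (map-∘ reps)) (map-cong-local (All.tabulate λ a∈ → dSet≡minimum v a∈))))

      length-reps : length reps ≡ t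
      length-reps = begin
        length reps                      ≡⟨ length-map colour reps ⟨
        length (map colour reps)         ≡⟨ length-map (λ i → i) (map colour reps) ⟨
        length (map _ (map colour reps)) ≡⟨ ↭-length (tabulate-↭ (λ i → i) reps! reps-cover) ⟨
        length (allFin t)                ≡⟨ length-tabulate (λ i → i) ⟩
        t                                ∎
        where open ≡-Reasoning

    assign : ∀ {x vs} {p : Assignment} a → (∀ y → y ∈ᴸ x ∷ vs ⊎ y ∈ᴸ map proj₁ p) →
             ∀ y → y ∈ᴸ vs ⊎ y ∈ᴸ map proj₁ ((x , a) ∷ p)
    assign a cover y with cover y
    ... | inj₁ (here eq)  = inj₂ (here eq)
    ... | inj₁ (there y∈) = inj₁ y∈
    ... | inj₂ y∈         = inj₂ (there y∈)

    -- The colours of `Π` steer the descent: a vertex joins the earlier representative of its colour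
    -- or opens a new part. At the leaf the profiles are the true representations up to order, so a
    -- resolving `Π` would make the sorted profiles distinct, contrary to exhaustion.
    exhausted⇒¬resolving : P t → Resolving G conn Π → ∀ reps p vs → Exhausted reps p vs →
      Consistent reps p → (∀ x → x ∈ᴸ vs ⊎ x ∈ᴸ map proj₁ p) → ⊥
    exhausted⇒¬resolving Pt res reps p [] ex cons cover =
      ex (subst P (sym (length-reps cons total)) Pt)
         (unique-map⁺ injective (allFin⁺ n))
      where
      total : ∀ x → x ∈ᴸ map proj₁ p
      total x with cover x
      ... | inj₂ x∈ = x∈
      injective : ∀ {u v} → sort (profile reps p u) ≡ sort (profile reps p v) → u ≡ v
      injective {u} {v} eq with u ≟ᶠ v
      ... | yes u≡v = u≡v
      ... | no  u≢v = ⊥-elim (res u v u≢v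
        (↭-trans (rmp↭profile cons total u) (↭-trans (↭-sym (sort-↭ (profile reps p u)))
        (↭-trans (↭-reflexive eq) (↭-trans (sort-↭ (profile reps p v))
        (↭-sym (rmp↭profile cons total v)))))))
    exhausted⇒¬resolving Pt res reps p (x ∷ vs) (new , old) cons cover
      with Any.any? (λ a → colour x ≟ᶠ colour a) reps
    ... | yes old∈ with a , a∈ , eq ← find old∈ =
      exhausted⇒¬resolving Pt res reps ((x , a) ∷ p) vs (All.lookup old a∈)
        (record { reps! = reps! ; coloured = (eq , a∈) ∷ coloured }) (assign a cover)
      where open Consistent cons
    ... | no new∉ =
      exhausted⇒¬resolving Pt res (x ∷ reps) ((x , x) ∷ p) vs new
        (record { reps!    = All.map⁺ (All.¬Any⇒All¬ reps new∉) ∷ reps!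
                ; coloured = (refl , here refl) ∷ All.map (λ (eq , a∈) → eq , there a∈) coloured })
        (assign x cover)
      where open Consistent cons

-- The metric of the cycle, certified by a finite check

cyclicDistance : ∀ {n} → Fin n → Fin n → ℕ
cyclicDistance {n} u v = let k = ∣ toℕ u - toℕ v ∣ in k ⊓ (n ∸ k)

module _ {n} (G : Graph n) (δ : Fin n → Fin n → ℕ) where

  -- The local criterion for every singleton {x}: decidable, and enough to force `δ` to be the
  -- distance.
  Metric : Set
  Metric = ∀ x → Local G (λ v → δ v x) × (∀ v → δ v x ≡ 0 → v ≡ x) × δ x x ≡ 0

  metric? : Dec Metric
  metric? = all? λ x → local? G (λ v → δ v x) ×-dec
    all? (λ v → (δ v x ≟ 0) →-dec (v ≟ᶠ x)) ×-dec (δ x x ≟ 0)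

  metric⇒d : (conn : Connected G) → Metric → ∀ u v → d G conn u v ≡ δ u v
  metric⇒d conn metric u v with metric v
  ... | loc , 0⇒≡ , δ≡0 with local-zero G loc u
  ...   | w , p , eq with refl ← 0⇒≡ w eq = ≤-antisym (d-minimal G conn p)
    (≤-trans (local-backward G loc (d-walk G conn u v))
      (≤-reflexive (trans (cong (d G conn u v +_) δ≡0) (+-identityʳ _))))

  refute : (conn : Connected G) → Metric → ∀ {P : ℕ → Set} (P? : Decidable P) →
           Search.Exhausted δ P? [] [] (allFin n) → ∀ {t} → P t → ¬ HasResolving G conn t
  refute conn metric P? ex Pt (Π , res) =
    exhausted⇒¬resolving G conn (metric⇒d conn metric) Π Pt res [] [] (allFin n) ex
      (record { reps! = [] ; coloured = [] }) (λ x → inj₁ (∈-allFin x))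
    where open Search δ P?

-- For a numeral `n` and a concrete `P?`, both `True` arguments evaluate to the unit type, so
-- passing `tt` runs the whole search during type checking.
refute-cycle : ∀ {n} (3≤n : 3 ≤ n) {P : ℕ → Set} (P? : Decidable P)
  {_ : True (metric? (cycle n 3≤n) cyclicDistance)}
  {_ : True (Search.exhausted? (cyclicDistance {n}) P? [] [] (allFin n))} →
  ∀ {t} → P t → ¬ HasResolving (cycle n 3≤n) (cycle-connected n 3≤n) t
refute-cycle {n} 3≤n P? {metric} {exhausted} =
  refute (cycle n 3≤n) cyclicDistance (cycle-connected n 3≤n) (toWitness metric) P? (toWitness exhausted)

-- Labellings read around a cycle

headOr lastOr : ∀ {A : Set} → A → List A → A
headOr c []      = c
headOr c (x ∷ _) = x
lastOr a []       = a
lastOr a (x ∷ xs) = lastOr x xs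

-- a and c are the neighbours of the list from outside.
Chain : {A : Set} → (A → A → A → Set) → A → List A → A → Set
Chain R a []       c = ⊤
Chain R a (x ∷ xs) c = R a x (headOr c xs) × Chain R x xs c

chain? : {A : Set} {R : A → A → A → Set} → (∀ a b c → Dec (R a b c)) →
         ∀ a xs c → Dec (Chain R a xs c)
chain? R? a []       c = yes tt
chain? R? a (x ∷ xs) c = R? a x (headOr c xs) ×-dec chain? R? x xs c

headOr-++ : ∀ {A : Set} {c : A} xs {ys} → headOr c (xs ++ ys) ≡ headOr (headOr c ys) xs
headOr-++ []      = refl
headOr-++ (_ ∷ _) = refl

-- At the seam each list takes the adjacent end of the other as its outer neighbour; `headOr` and
-- `lastOr` fall through to the far neighbour when a list is empty.
chain-++ : ∀ {A : Set} {R : A → A → A → Set} {a c} xs {ys} →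
           Chain R a xs (headOr c ys) → Chain R (lastOr a xs) ys c → Chain R a (xs ++ ys) c
chain-++ []       _          ch′ = ch′
chain-++ {R = R} {a} {c} (x ∷ xs) {ys} (r , ch) ch′ =
  subst (R a x) (sym (headOr-++ xs)) r , chain-++ xs ch ch′

module _ {A : Set} where

  before : A → (xs : List A) → Fin (length xs) → A
  before a (x ∷ xs) zero    = a
  before a (x ∷ xs) (suc i) = before x xs i

  after : (xs : List A) → A → Fin (length xs) → A
  after (x ∷ xs) c zero    = headOr c xs
  after (x ∷ xs) c (suc i) = after xs c i

  chain-lookup : ∀ {R : A → A → A → Set} {a xs c} → Chain R a xs c →
                 ∀ i → R (before a xs i) (lookup xs i) (after xs c i)
  chain-lookup {xs = _ ∷ _} (r , _)  zero    = r
  chain-lookup {xs = _ ∷ _} (_ , ch) (suc i) = chain-lookup ch i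

  before-zero : ∀ {a} xs {i} → toℕ i ≡ 0 → before a xs i ≡ a
  before-zero (_ ∷ _) {zero} _ = refl

  before-suc : ∀ {a} xs {i j} → toℕ j ≡ suc (toℕ i) → before a xs j ≡ lookup xs i
  before-suc (_ ∷ xs) {zero}  {suc j} eq = before-zero xs (suc-injective eq)
  before-suc (_ ∷ xs) {suc i} {suc j} eq = before-suc xs (suc-injective eq)

  lookup-zero : ∀ {c : A} xs {i} → toℕ i ≡ 0 → lookup xs i ≡ headOr c xs
  lookup-zero (_ ∷ _) {zero} _ = refl

  lookup-last : ∀ {a : A} xs {i} → suc (toℕ i) ≡ length xs → lookup xs i ≡ lastOr a xs
  lookup-last (_ ∷ [])     {zero}  _  = refl
  lookup-last (_ ∷ xs)     {suc i} eq = lookup-last xs (suc-injective eq)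

  after-suc : ∀ {c} xs {i j} → toℕ j ≡ suc (toℕ i) → after xs c i ≡ lookup xs j
  after-suc (_ ∷ xs) {zero}  {suc j} eq = sym (lookup-zero xs (suc-injective eq))
  after-suc (_ ∷ xs) {suc i} {suc j} eq = after-suc xs (suc-injective eq)

  after-last : ∀ {c} xs {i} → suc (toℕ i) ≡ length xs → after xs c i ≡ c
  after-last (_ ∷ [])     {zero}  _  = refl
  after-last (_ ∷ xs)     {suc i} eq = after-last xs (suc-injective eq)

next-exists : ∀ {n} (v : Fin n) → ∃ (Next v)
next-exists {suc n} v with suc (toℕ v) <? suc n
... | yes lt = fromℕ< lt , inj₁ (toℕ-fromℕ< lt)
... | no  ge = zero , inj₂ (≤-antisym (toℕ<n v) (≮⇒≥ ge) , refl)

prev-exists : ∀ {n} (v : Fin n) → ∃ λ u → Next u v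
prev-exists {suc n} zero    = fromℕ< (n<1+n n) , inj₂ (cong suc (toℕ-fromℕ< (n<1+n n)) , refl)
prev-exists {suc n} (suc v) = inject₁ v , inj₁ (cong suc (sym (toℕ-inject₁ v)))

-- Local, at a vertex with value b between neighbours with values a and c.
Eikonal : ℕ → ℕ → ℕ → Set
Eikonal a b c = b ≡ 0 ⊎ b ≡ suc (a ⊓ c)

eikonal-≤ : ∀ {a b c} → Eikonal a b c → b ≤ suc a × b ≤ suc c
eikonal-≤ (inj₁ refl) = z≤n , z≤n
eikonal-≤ (inj₂ refl) = s≤s (m⊓n≤m _ _) , s≤s (m⊓n≤n _ _)

Eikonalⱽ : ∀ {t} → Vec ℕ t → Vec ℕ t → Vec ℕ t → Set
Eikonalⱽ a b c = ∀ i → Eikonal (Vec.lookup a i) (Vec.lookup b i) (Vec.lookup c i)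

eikonalⱽ? : ∀ {t} (a b c : Vec ℕ t) → Dec (Eikonalⱽ a b c)
eikonalⱽ? a b c = all? λ i → (_ ≟ _) ⊎-dec (_ ≟ _)

OneZero : ∀ {t} → Vec ℕ t → Set
OneZero x = ∃ λ i → Vec.lookup x i ≡ 0 × ∀ j → Vec.lookup x j ≡ 0 → j ≡ i

oneZero? : ∀ {t} (x : Vec ℕ t) → Dec (OneZero x)
oneZero? x = any? λ i → (_ ≟ _) ×-dec all? λ j → (_ ≟ _) →-dec (j ≟ᶠ i)

-- A permutation invariant, so different fingerprints mean different multisets. For symbolic entries
-- it stays polynomial, where a sorted list would need case distinctions.
fingerprint : ∀ {t} → Vec ℕ t → ℕ × ℕ
fingerprint x = sum (entries x) , sum (map (λ k → k * k) (entries x))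
  where
  entries : ∀ {t} → Vec ℕ t → List ℕ
  entries x = tabulate (Vec.lookup x)

_#_ : ∀ {t} → Vec ℕ t → Vec ℕ t → Set
x # y = fingerprint x ≢ fingerprint y

lookup-AllPairs : ∀ {A : Set} {R : A → A → Set} {xs} → (∀ {x y} → R x y → R y x) → AllPairs R xs →
                  ∀ i j → i ≢ j → R (lookup xs i) (lookup xs j)
lookup-AllPairs s (_  ∷ _)  zero    zero    i≢j = ⊥-elim (i≢j refl)
lookup-AllPairs s (px ∷ _)  zero    (suc j) _   = All.lookup px (∈-lookup j)
lookup-AllPairs s (px ∷ _)  (suc i) zero    _   = s (All.lookup px (∈-lookup i))
lookup-AllPairs s (_  ∷ ps) (suc i) (suc j) i≢j = lookup-AllPairs s ps i j (i≢j ∘ cong suc)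

-- Taking the last and the first entry as outer neighbours closes the list into a cycle, so
-- `Chain Eikonalⱽ` is the local criterion at every vertex, including the wrap-around.
cycle-labels : ∀ {t n} (3≤n : 3 ≤ n) x (xs : List (Vec ℕ t)) → length (x ∷ xs) ≡ n →
  Chain Eikonalⱽ (lastOr x xs) (x ∷ xs) x → All OneZero (x ∷ xs) → AllPairs _#_ (x ∷ xs) →
  HasResolving (cycle n 3≤n) (cycle-connected n 3≤n) t
cycle-labels {t} 3≤n x xs refl ch one distinct = hasResolving zero λ u v u≢v p →
  lookup-AllPairs (_∘ sym) distinct u v u≢v
    (cong₂ _,_ (sum-↭ p) (sum-↭ (map⁺ (λ k → k * k) p)))
  where
  G = cycle _ 3≤n
  ys = x ∷ xs
  ℓ : Fin t → Fin (length ys) → ℕ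
  ℓ i v = Vec.lookup (lookup ys v) i

  successor : ∀ {v w} → Next v w → after ys x v ≡ lookup ys w
  successor (inj₁ eq)         = after-suc ys eq
  successor (inj₂ (eq , eq₀)) = trans (after-last ys eq) (sym (lookup-zero {c = x} ys eq₀))

  predecessor : ∀ {v w} → Next w v → before (lastOr x xs) ys v ≡ lookup ys w
  predecessor (inj₁ eq)         = before-suc ys eq
  predecessor (inj₂ (eq , eq₀)) = trans (before-zero ys eq₀) (sym (lookup-last {a = x} ys eq))

  eikonal : ∀ i {u v w} → Next u v → Next v w → Eikonal (ℓ i u) (ℓ i v) (ℓ i w)
  eikonal i {u} {v} {w} uv vw =
    subst₂ (λ a c → Eikonal (Vec.lookup a i) (ℓ i v) (Vec.lookup c i))
      (predecessor uv) (successor vw) (chain-lookup ch v i)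

  ℓ-local : ∀ i → Local G (ℓ i)
  ℓ-local i v with prev-exists v | next-exists v
  ... | u , uv | w , vw = lipschitz , descent (eikonal i uv vw)
    where
    -- `eikonal` accepts any successor or predecessor, so `z` itself takes the place of `w` or `u`.
    lipschitz : ∀ z → Graph.Adj G v z → ℓ i v ≤ suc (ℓ i z)
    lipschitz z (inj₁ vz) = proj₂ (eikonal-≤ {ℓ i u} (eikonal i uv vz))
    lipschitz z (inj₂ zv) = proj₁ (eikonal-≤ {c = ℓ i w} (eikonal i zv vw))
    descent : Eikonal (ℓ i u) (ℓ i v) (ℓ i w) →
              ℓ i v ≡ 0 ⊎ ∃ λ z → Graph.Adj G v z × ℓ i v ≡ suc (ℓ i z)
    descent (inj₁ eq) = inj₁ eq
    descent (inj₂ eq) with ⊓-sel (ℓ i u) (ℓ i w)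
    ... | inj₁ eq′ = inj₂ (u , inj₂ uv , trans eq (cong suc eq′))
    ... | inj₂ eq′ = inj₂ (w , inj₁ vw , trans eq (cong suc eq′))

  labelling : Labelling G (cycle-connected _ 3≤n) t
  labelling = record
    { label    = ℓ
    ; local    = ℓ-local
    ; disjoint = λ i j v p q → let _ , _ , only = All.lookup one (∈-lookup v) in
                               trans (only i p) (sym (only j q))
    ; covers   = λ v → let i , eq , _ = All.lookup one (∈-lookup v) in i , eq
    }
  open Labelling labelling using (hasResolving)

-- Explicit resolving partitions

Valid : ∀ {t} → Vec ℕ t → List (Vec ℕ t) → Set
Valid x xs = Chain Eikonalⱽ (lastOr x xs) (x ∷ xs) x × All OneZero (x ∷ xs) × AllPairs _#_ (x ∷ xs)

valid? : ∀ {t} x (xs : List (Vec ℕ t)) → Dec (Valid x xs)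
valid? x xs = chain? eikonalⱽ? (lastOr x xs) (x ∷ xs) x ×-dec All.all? oneZero? (x ∷ xs)
        ×-dec allPairs? (λ x y → ¬? (≡-dec _≟_ _≟_ (fingerprint x) (fingerprint y))) (x ∷ xs)

cycle-valid : ∀ {t n} (3≤n : 3 ≤ n) (x : Vec ℕ t) xs → length (x ∷ xs) ≡ n → Valid x xs →
              HasResolving (cycle n 3≤n) (cycle-connected n 3≤n) t
cycle-valid 3≤n x xs eq (a , b , c) = cycle-labels 3≤n x xs eq a b c

-- Counting from 0, vertices 2, 4, 6, 7 are singletons and the other four form one part.
resolving₈ : ∀ {n} (3≤n : 3 ≤ n) → 8 ≡ n → HasResolving (cycle n 3≤n) (cycle-connected n 3≤n) 5
resolving₈ 3≤n eq = cycle-valid 3≤n x xs eq (toWitness {a? = valid? x xs} tt)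
  where
  x = 0 ∷ 2 ∷ 4 ∷ 2 ∷ 1 ∷ []
  xs = (0 ∷ 1 ∷ 3 ∷ 3 ∷ 2 ∷ [])
     ∷ (1 ∷ 0 ∷ 2 ∷ 4 ∷ 3 ∷ [])
     ∷ (0 ∷ 1 ∷ 1 ∷ 3 ∷ 4 ∷ [])
     ∷ (1 ∷ 2 ∷ 0 ∷ 2 ∷ 3 ∷ [])
     ∷ (0 ∷ 3 ∷ 1 ∷ 1 ∷ 2 ∷ [])
     ∷ (1 ∷ 4 ∷ 2 ∷ 0 ∷ 1 ∷ [])
     ∷ (1 ∷ 3 ∷ 3 ∷ 1 ∷ 0 ∷ [])
     ∷ []

-- Vertices 1, 6, 7 are singletons and the others form one part.
resolving₉ : ∀ {n} (3≤n : 3 ≤ n) → 9 ≡ n → HasResolving (cycle n 3≤n) (cycle-connected n 3≤n) 4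
resolving₉ 3≤n eq = cycle-valid 3≤n x xs eq (toWitness {a? = valid? x xs} tt)
  where
  x = 0 ∷ 1 ∷ 3 ∷ 2 ∷ []
  xs = (1 ∷ 0 ∷ 4 ∷ 3 ∷ [])
     ∷ (0 ∷ 1 ∷ 4 ∷ 4 ∷ [])
     ∷ (0 ∷ 2 ∷ 3 ∷ 4 ∷ [])
     ∷ (0 ∷ 3 ∷ 2 ∷ 3 ∷ [])
     ∷ (0 ∷ 4 ∷ 1 ∷ 2 ∷ [])
     ∷ (1 ∷ 4 ∷ 0 ∷ 1 ∷ [])
     ∷ (1 ∷ 3 ∷ 1 ∷ 0 ∷ [])
     ∷ (0 ∷ 2 ∷ 2 ∷ 1 ∷ [])
     ∷ []

-- Vertices 1, 7, 8 are singletons and the others form one part.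
resolving₁₀ : ∀ {n} (3≤n : 3 ≤ n) → 10 ≡ n → HasResolving (cycle n 3≤n) (cycle-connected n 3≤n) 4
resolving₁₀ 3≤n eq = cycle-valid 3≤n x xs eq (toWitness {a? = valid? x xs} tt)
  where
  x = 0 ∷ 1 ∷ 3 ∷ 2 ∷ []
  xs = (1 ∷ 0 ∷ 4 ∷ 3 ∷ [])
     ∷ (0 ∷ 1 ∷ 5 ∷ 4 ∷ [])
     ∷ (0 ∷ 2 ∷ 4 ∷ 5 ∷ [])
     ∷ (0 ∷ 3 ∷ 3 ∷ 4 ∷ [])
     ∷ (0 ∷ 4 ∷ 2 ∷ 3 ∷ [])
     ∷ (0 ∷ 5 ∷ 1 ∷ 2 ∷ [])
     ∷ (1 ∷ 4 ∷ 0 ∷ 1 ∷ [])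
     ∷ (1 ∷ 3 ∷ 1 ∷ 0 ∷ [])
     ∷ (0 ∷ 2 ∷ 2 ∷ 1 ∷ [])
     ∷ []

-- Labels along the two arcs of D

lastOr-++ : ∀ {A : Set} {a : A} xs {ys} → lastOr a (xs ++ ys) ≡ lastOr (lastOr a xs) ys
lastOr-++ []       = refl
lastOr-++ (_ ∷ xs) = lastOr-++ xs

-- The distances to A, B, C and D, in this order.
Label : Set
Label = Vec ℕ 4

pattern ⟨_,_,_,_⟩ a b c d = a ∷ b ∷ c ∷ d ∷ []

eikonal₄ : ∀ {a₀ a₁ a₂ a₃ b₀ b₁ b₂ b₃ c₀ c₁ c₂ c₃} →
           Eikonal a₀ b₀ c₀ → Eikonal a₁ b₁ c₁ → Eikonal a₂ b₂ c₂ → Eikonal a₃ b₃ c₃ →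
           Eikonalⱽ ⟨ a₀ , a₁ , a₂ , a₃ ⟩ ⟨ b₀ , b₁ , b₂ , b₃ ⟩ ⟨ c₀ , c₁ , c₂ , c₃ ⟩
eikonal₄ p q r s zero                   = p
eikonal₄ p q r s (suc zero)             = q
eikonal₄ p q r s (suc (suc zero))       = r
eikonal₄ p q r s (suc (suc (suc zero))) = s

eikonalˡ : ∀ {a c} → a ≤ c → Eikonal a (suc a) c
eikonalˡ a≤c = inj₂ (cong suc (sym (m≤n⇒m⊓n≡m a≤c)))

eikonalʳ : ∀ {a c} → c ≤ a → Eikonal a (suc c) c
eikonalʳ c≤a = inj₂ (cong suc (sym (m≥n⇒m⊓n≡n c≤a)))

-- The vertices of D on the way from B to C are rising, those on the way from
-- C to A falling.
rising : ℕ → ℕ → List Label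
rising i zero    = []
rising i (suc y) = ⟨ suc i , i , suc y , 0 ⟩ ∷ rising (suc i) y

falling : ℕ → ℕ → List Label
falling zero    y = []
falling (suc j) y = ⟨ suc j , suc (suc j) , y , 0 ⟩ ∷ falling j (suc y)

length-rising : ∀ i y → length (rising i y) ≡ y
length-rising i zero    = refl
length-rising i (suc y) = cong suc (length-rising (suc i) y)

length-falling : ∀ j y → length (falling j y) ≡ j
length-falling zero    y = refl
length-falling (suc j) y = cong suc (length-falling j (suc y))

lastOr-rising : ∀ {a} i y → lastOr a (rising i (suc y)) ≡ ⟨ suc (y + i) , y + i , 1 , 0 ⟩
lastOr-rising i zero    = refl
lastOr-rising i (suc y) = trans (lastOr-rising {⟨ suc i , i , suc (suc y) , 0 ⟩} (suc i) y)
  (cong (λ k → ⟨ suc k , k , 1 , 0 ⟩) (+-suc y i))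

lastOr-falling : ∀ {a} j y → lastOr a (falling (suc j) y) ≡ ⟨ 1 , 2 , j + y , 0 ⟩
lastOr-falling zero    y = refl
lastOr-falling (suc j) y = trans (lastOr-falling {⟨ suc (suc j) , suc (suc (suc j)) , y , 0 ⟩} j (suc y))
  (cong (λ k → ⟨ 1 , 2 , k , 0 ⟩) (+-suc j y))

-- The distances to A and B come from the preceding vertex, the distance to C from the following
-- one. The three inequalities say that the outer neighbours at the two ends of the block offer no
-- shorter route.
chain-rising : ∀ i y {a₂ a₃ c₀ c₁ c₃} → y ≤ suc a₂ → y + i ≤ c₀ → y + i ≤ suc c₁ →
  Chain Eikonalⱽ ⟨ suc i , i , a₂ , a₃ ⟩ (rising (suc i) y) ⟨ c₀ , c₁ , 0 , c₃ ⟩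
chain-rising i zero          _ _  _        = tt
chain-rising i (suc zero) {a₂} _ p₀ (s≤s p₁) =
  eikonal₄ (eikonalˡ p₀) (eikonalˡ p₁) (eikonalʳ {a₂} z≤n) (inj₁ refl) , tt
chain-rising i (suc (suc y)) {c₀ = c₀} {c₁} {c₃} (s≤s p₂) p₀ p₁ =
  eikonal₄ (eikonalˡ (m≤n+m _ 2)) (eikonalˡ (m≤n+m _ 2)) (eikonalʳ p₂) (inj₁ refl) ,
  chain-rising (suc i) (suc y) {c₀ = c₀} {c₁} {c₃} (≤-trans (n≤1+n _) (n≤1+n _))
    (subst (_≤ c₀) (sym (+-suc (suc y) i)) p₀) (subst (_≤ suc c₁) (sym (+-suc (suc y) i)) p₁)

chain-falling : ∀ j y {a₀ a₁ a₃ c₂ c₃} → j ≤ a₀ → suc j ≤ a₁ → j + y ≤ suc c₂ →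
  Chain Eikonalⱽ ⟨ a₀ , a₁ , y , a₃ ⟩ (falling j (suc y)) ⟨ 0 , 1 , c₂ , c₃ ⟩
chain-falling zero          y _  _  _  = tt
chain-falling (suc zero)    y p₀ p₁ (s≤s p₂) =
  eikonal₄ (eikonalʳ z≤n) (eikonalʳ (≤-trans (n≤1+n 1) p₁)) (eikonalˡ p₂) (inj₁ refl) , tt
chain-falling (suc (suc j)) y {c₂ = c₂} {c₃} p₀ p₁ p₂ =
  eikonal₄ (eikonalʳ (≤-trans (n≤1+n _) p₀)) (eikonalʳ (≤-trans (n≤1+n _) p₁))
           (eikonalˡ (m≤n+m _ 2)) (inj₁ refl) ,
  chain-falling (suc j) (suc y) {c₂ = c₂} {c₃} (n≤1+n _) (n≤1+n _) (subst (_≤ suc c₂) (sym (+-suc (suc j) y)) p₂)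

oneZero₃ : ∀ {a b c} → OneZero ⟨ suc a , suc b , suc c , 0 ⟩
oneZero₃ {a} {b} {c} = suc (suc (suc zero)) , refl , only
  where
  only : ∀ j → Vec.lookup ⟨ suc a , suc b , suc c , 0 ⟩ j ≡ 0 → j ≡ suc (suc (suc zero))
  only (suc (suc (suc zero))) _ = refl

oneZero₂ : ∀ {a b d} → OneZero ⟨ suc a , suc b , 0 , suc d ⟩
oneZero₂ {a} {b} {d} = suc (suc zero) , refl , only
  where
  only : ∀ j → Vec.lookup ⟨ suc a , suc b , 0 , suc d ⟩ j ≡ 0 → j ≡ suc (suc zero)
  only (suc (suc zero))       _ = refl
  only (suc (suc (suc zero))) ()

oneZero₀ : ∀ {b c d} → OneZero ⟨ 0 , suc b , suc c , suc d ⟩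
oneZero₀ {b} {c} {d} = zero , refl , only
  where
  only : ∀ j → Vec.lookup ⟨ 0 , suc b , suc c , suc d ⟩ j ≡ 0 → j ≡ zero
  only zero                   _ = refl
  only (suc (suc (suc zero))) ()

oneZero₁ : ∀ {a c d} → OneZero ⟨ suc a , 0 , suc c , suc d ⟩
oneZero₁ {a} {c} {d} = suc zero , refl , only
  where
  only : ∀ j → Vec.lookup ⟨ suc a , 0 , suc c , suc d ⟩ j ≡ 0 → j ≡ suc zero
  only (suc zero)             _ = refl
  only (suc (suc (suc zero))) ()

oneZero-rising : ∀ i y → All OneZero (rising (suc i) y)
oneZero-rising i zero    = []
oneZero-rising i (suc y) = oneZero₃ ∷ oneZero-rising (suc i) y

oneZero-falling : ∀ j y → All OneZero (falling j (suc y))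
oneZero-falling zero    y = []
oneZero-falling (suc j) y = oneZero₃ ∷ oneZero-falling j (suc y)

-- Sums and sums of squares of the labels

Σ₁ : Label → ℕ
Σ₁ x = proj₁ (fingerprint x)

rising-head : ∀ i y → 1 + (i + (i + (1 + y))) ≡ 1 + i + (i + (1 + y + 0))
rising-head = solve-∀

rising-tail : ∀ i y → 2 + (i + (i + (1 + y))) ≡ 1 + (1 + i + (1 + i + y))
rising-tail = solve-∀

falling-head : ∀ j y → 1 + (1 + j + (1 + j + y)) ≡ 1 + j + (2 + j + (y + 0))
falling-head = solve-∀

falling-tail : ∀ j y → 2 + (j + (j + (1 + y))) ≡ 1 + (1 + j + (1 + j + y))
falling-tail = solve-∀

-- Each step adds one to the distances to A and B and takes one from the distance to C, so the sum
-- grows by one; for a nonempty block it starts at `suc (i + (i + y))`. In `falling` the sum drops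
-- by one per step instead.
rising-Σ₁ : ∀ {s} i y → s < suc (i + (i + y)) → All (λ x → s < Σ₁ x) (rising i y)
rising-Σ₁ i zero    _ = []
rising-Σ₁ {s} i (suc y) p =
  subst (s <_) (rising-head i y) p ∷
  rising-Σ₁ (suc i) y (≤-trans p (≤-trans (n≤1+n _) (≤-reflexive (rising-tail i y))))

falling-Σ₁ : ∀ {s} j y → suc (j + (j + y)) < s → All (λ x → Σ₁ x < s) (falling j y)
falling-Σ₁ zero    y _ = []
falling-Σ₁ {s} (suc j) y p =
  subst (_< s) (falling-head j y) p ∷
  falling-Σ₁ j (suc y) (≤-trans (≤-trans (≤-reflexive (falling-tail j y)) (n≤1+n _)) p)

by-Σ₁ : ∀ {x y : Label} → Σ₁ x ≢ Σ₁ y → x # y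
by-Σ₁ neq eq = neq (cong proj₁ eq)

rising-# : ∀ i y → AllPairs _#_ (rising i y)
rising-# i zero    = []
rising-# i (suc y) =
  All.map (λ {x} lt → by-Σ₁ {⟨ suc i , i , suc y , 0 ⟩} {x} (<⇒≢ lt))
    (rising-Σ₁ (suc i) y (≤-reflexive
      (trans (cong suc (sym (rising-head i y))) (rising-tail i y)))) ∷
  rising-# (suc i) y

falling-# : ∀ j y → AllPairs _#_ (falling j y)
falling-# zero    y = []
falling-# (suc j) y =
  All.map (λ {x} lt → by-Σ₁ {⟨ suc j , suc (suc j) , y , 0 ⟩} {x} (≢-sym (<⇒≢ lt)))
    (falling-Σ₁ j (suc y) (≤-reflexive
      (trans (falling-tail j y) (falling-head j y)))) ∷
  falling-# j (suc y)

-- Along either arc the distances to its two ends, B and C or A and C, have the constant sum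
-- `2 + s`, so for fixed `s` one parameter determines a label.
Rising Falling : ℕ → Label → Set
Rising  s x = ∃₂ λ i y → i + y ≡ s × x ≡ ⟨ 2 + i , 1 + i , 1 + y , 0 ⟩
Falling s x = ∃₂ λ j z → j + z ≡ s × x ≡ ⟨ 1 + j , 2 + j , 1 + z , 0 ⟩

rising-form : ∀ {s} i y → i + y ≡ suc s → All (Rising s) (rising (suc i) y)
rising-form i zero    _  = []
rising-form i (suc y) eq =
  (i , y , suc-injective (trans (sym (+-suc i y)) eq) , refl) ∷
  rising-form (suc i) y (trans (sym (+-suc i y)) eq)

falling-form : ∀ {s} j z → j + z ≡ suc s → All (Falling s) (falling j (suc z))
falling-form zero    z _  = []
falling-form (suc j) z eq =
  (j , z , suc-injective eq , refl) ∷ falling-form j (suc z) (trans (+-suc j z) eq)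

-- The sums and sums of squares below are written as fingerprint unfolds.
Σ₁-rising : ∀ i y → (2 + i) + ((1 + i) + ((1 + y) + (0 + 0))) ≡ 4 + (i + (i + y))
Σ₁-rising = solve-∀

Σ₁-falling : ∀ j z → (1 + j) + ((2 + j) + ((1 + z) + (0 + 0))) ≡ 4 + (j + (j + z))
Σ₁-falling = solve-∀

Σ₁-A : ∀ m → 0 + (1 + ((3 + m) + (1 + 0))) ≡ 5 + m
Σ₁-A = solve-∀

Σ₁-B : ∀ m → 1 + (0 + ((4 + m) + (1 + 0))) ≡ 6 + m
Σ₁-B = solve-∀

Σ₁-C : ∀ m → (3 + m) + ((4 + m) + (0 + (1 + 0))) ≡ 8 + (m + m)
Σ₁-C = solve-∀

Σ₂-rising-C : ∀ m →
  (3 + m) * (3 + m) + ((4 + m) * (4 + m) + (0 * 0 + (1 * 1 + 0))) ≡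
  1 + ((2 + (1 + m)) * (2 + (1 + m)) + ((1 + (1 + m)) * (1 + (1 + m)) + ((1 + 2) * (1 + 2) + (0 * 0 + 0))) + (3 + 4 * m))
Σ₂-rising-C = solve-∀

Σ₂-falling-A : ∀ m →
  0 * 0 + (1 * 1 + ((3 + m) * (3 + m) + (1 * 1 + 0))) ≡
  1 + ((1 + 0) * (1 + 0) + ((2 + 0) * (2 + 0) + ((1 + (1 + m)) * (1 + (1 + m)) + (0 * 0 + 0))) + (1 + 2 * m))
Σ₂-falling-A = solve-∀

Σ₂-falling-B : ∀ m →
  1 * 1 + (0 * 0 + ((4 + m) * (4 + m) + (1 * 1 + 0))) ≡
  1 + ((1 + 1) * (1 + 1) + ((2 + 1) * (2 + 1) + ((1 + m) * (1 + m) + (0 * 0 + 0))) + (3 + 6 * m))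
Σ₂-falling-B = solve-∀

Σ₂-rising-falling₁ : ∀ i z →
  (2 + i) * (2 + i) + ((1 + i) * (1 + i) + ((1 + (4 + z)) * (1 + (4 + z)) + (0 * 0 + 0))) ≡
  (26 + 6 * i + 2 * (i * i) + 2 * z + z * z) + 4 * (1 + 2 * z)
Σ₂-rising-falling₁ = solve-∀

Σ₂-rising-falling₂ : ∀ i z →
  (1 + (2 + i)) * (1 + (2 + i)) + ((2 + (2 + i)) * (2 + (2 + i)) + ((1 + z) * (1 + z) + (0 * 0 + 0))) ≡
  (26 + 6 * i + 2 * (i * i) + 2 * z + z * z) + 4 * (2 * i)
Σ₂-rising-falling₂ = solve-∀

+-4 : ∀ i z → 4 + (i + z) ≡ i + (4 + z)
+-4 = solve-∀

-- The infinite family of four-part partitions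

module Family (m : ℕ) where

  -- The arc from A to C avoiding B has `l` edges, the arc from B to C avoiding A has `2 + l`. Hence
  -- B is closest to C through A, at distance `1 + l`.
  l : ℕ
  l = 3 + m

  -- `labelC` belongs to the vertex of C on the side of A; the remaining vertices of C depend on the
  -- parity of n.
  labelA labelB labelC : Label
  labelA = ⟨ 0 , 1 , l , 1 ⟩
  labelB = ⟨ 1 , 0 , 1 + l , 1 ⟩
  labelC = ⟨ l , 1 + l , 0 , 1 ⟩

  -- The sums run from 7 + m to 10 + 2m on the rising arc and from 5 + m to 6 + 2m on the falling
  -- one; `labelA`, `labelB`, `labelC` have 5 + m, 6 + m, 8 + 2m. Squares are called for only where
  -- these coincide.
  Σ₁-Rising : ∀ {x} → Rising l x → ∃ λ i → i ≤ l × Σ₁ x ≡ 7 + (i + m)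
  Σ₁-Rising (i , y , eq , refl) = i , m+n≤o⇒m≤o i (≤-reflexive eq) ,
    trans (Σ₁-rising i y) (trans (cong (λ k → 4 + (i + k)) eq) (shift i m))
    where
    shift : ∀ i m → 4 + (i + (3 + m)) ≡ 7 + (i + m)
    shift i m = cong (4 +_) (trans (+-comm i (3 + m)) (cong (3 +_) (+-comm m i)))

  Σ₁-Falling : ∀ {x} → Falling (1 + m) x → ∃ λ j → j ≤ 1 + m × Σ₁ x ≡ 5 + (j + m)
  Σ₁-Falling (j , z , eq , refl) = j , m+n≤o⇒m≤o j (≤-reflexive eq) ,
    trans (Σ₁-falling j z) (trans (cong (λ k → 4 + (j + k)) eq) (cong (4 +_) (+-suc j m)))

  rising-A : ∀ {x} → Rising l x → x # labelA
  rising-A {x} r with Σ₁-Rising r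
  ... | i , _ , Σ≡ = by-Σ₁ {x} {labelA} λ eq →
    m≢1+n+m m {1 + i} (+-cancelˡ-≡ 5 _ _ (trans (sym (Σ₁-A m)) (trans (sym eq) Σ≡)))

  rising-B : ∀ {x} → Rising l x → x # labelB
  rising-B {x} r with Σ₁-Rising r
  ... | i , _ , Σ≡ = by-Σ₁ {x} {labelB} λ eq →
    m≢1+n+m m {i} (+-cancelˡ-≡ 6 _ _ (trans (sym (Σ₁-B m)) (trans (sym eq) Σ≡)))

  -- Equal sums force i = 1 + m and y = 2, where the sum of squares of `labelC` is larger by 4 + 4m.
  rising-C : ∀ {x} → Rising l x → x # labelC
  rising-C r@(i , y , i+y≡l , refl) eq
    with refl ← +-cancelʳ-≡ m i (1 + m) (+-cancelˡ-≡ 7 _ _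
      (trans (sym (proj₂ (proj₂ (Σ₁-Rising r)))) (trans (cong proj₁ eq) (Σ₁-C m))))
    with refl ← +-cancelˡ-≡ (1 + m) y 2 (trans i+y≡l (cong suc (+-comm 2 m)))
    = m≢1+m+n _ (trans (cong proj₂ eq) (Σ₂-rising-C m))

  -- Equal sums force j = 2 + i, and then equal sums of squares force
  -- 4 (1 + 2 z) = 8 i.
  rising-falling : ∀ {x y} → Rising l x → Falling (1 + m) y → x # y
  rising-falling r@(i , y , i+y≡l , refl) f@(j , z , j+z≡ , refl) eq
    with refl ← +-cancelʳ-≡ m j (2 + i) (+-cancelˡ-≡ 5 _ _
      (trans (sym (proj₂ (proj₂ (Σ₁-Falling f))))
        (trans (sym (cong proj₁ eq)) (proj₂ (proj₂ (Σ₁-Rising r))))))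
    with refl ← +-cancelˡ-≡ i y (4 + z) (trans i+y≡l (trans (cong (2 +_) (sym j+z≡)) (+-4 i z)))
    = even≢odd i z (sym (*-cancelˡ-≡ _ _ 4 (+-cancelˡ-≡ (26 + 6 * i + 2 * (i * i) + 2 * z + z * z) _ _
        (trans (sym (Σ₂-rising-falling₁ i z)) (trans (cong proj₂ eq) (Σ₂-rising-falling₂ i z))))))

  -- Equal sums force j = 0 and z = 1 + m, where the sum of squares of `labelA` is larger by 2 + 2m.
  falling-A : ∀ {x} → Falling (1 + m) x → x # labelA
  falling-A f@(j , z , j+z≡ , refl) eq
    with refl ← +-cancelʳ-≡ m j 0 (+-cancelˡ-≡ 5 _ _
      (trans (sym (proj₂ (proj₂ (Σ₁-Falling f)))) (trans (cong proj₁ eq) (Σ₁-A m))))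
    with refl ← j+z≡
    = m≢1+m+n _ (trans (sym (cong proj₂ (sym eq))) (Σ₂-falling-A m))

  -- Equal sums force j = 1 and z = m, where the sum of squares of `labelB` is larger by 4 + 6m.
  falling-B : ∀ {x} → Falling (1 + m) x → x # labelB
  falling-B f@(j , z , j+z≡ , refl) eq
    with refl ← +-cancelʳ-≡ m j 1 (+-cancelˡ-≡ 5 _ _
      (trans (sym (proj₂ (proj₂ (Σ₁-Falling f)))) (trans (cong proj₁ eq) (Σ₁-B m))))
    with refl ← suc-injective j+z≡
    = m≢1+m+n _ (trans (cong proj₂ eq) (Σ₂-falling-B m))

  C-falling : ∀ {x} → Falling (1 + m) x → labelC # x
  C-falling {x} f with Σ₁-Falling f
  ... | j , j≤ , Σ≡ = by-Σ₁ {labelC} {x} λ eq →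
    <⇒≢ (s≤s (≤-trans j≤ (n≤1+n (1 + m))))
      (sym (+-cancelʳ-≡ m (3 + m) j (+-cancelˡ-≡ 5 _ _ (trans (sym (Σ₁-C m)) (trans eq Σ≡)))))

  C-A : labelC # labelA
  C-A = by-Σ₁ {labelC} {labelA} λ eq →
    m≢1+n+m m {2 + m} (+-cancelˡ-≡ 5 _ _ (trans (sym (Σ₁-A m)) (trans (sym eq) (Σ₁-C m))))

  C-B : labelC # labelB
  C-B = by-Σ₁ {labelC} {labelB} λ eq →
    m≢1+n+m m {1 + m} (+-cancelˡ-≡ 6 _ _ (trans (sym (Σ₁-B m)) (trans (sym eq) (Σ₁-C m))))

  A-B : labelA # labelB
  A-B = by-Σ₁ {labelA} {labelB} λ eq → 1+n≢n (sym (trans (sym (Σ₁-A m)) (trans eq (Σ₁-B m))))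

  -- The threshold is one above the largest sum outside the middle of C, so the sum alone separates
  -- the middle labels from all others.
  High : Label → Set
  High x = 11 + (m + m) ≤ Σ₁ x

  rising-high : ∀ {x y} → Rising l x → High y → x # y
  rising-high {x} {y} r h with Σ₁-Rising r
  ... | i , i≤l , Σ≡ = by-Σ₁ {x} {y} (<⇒≢ (≤-trans
    (≤-trans (≤-reflexive (cong suc Σ≡)) (+-monoʳ-≤ 8 (+-monoˡ-≤ m i≤l))) h))

  low : ∀ {x y k} → High x → Σ₁ y ≡ k → k ≤ 10 + (m + m) → x # y
  low {x} {y} h Σ≡ k≤ = by-Σ₁ {x} {y} (≢-sym (<⇒≢ (≤-trans (s≤s (≤-trans (≤-reflexive Σ≡) k≤)) h)))

  high-falling : ∀ {x y} → High x → Falling (1 + m) y → x # y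
  high-falling {x} {y} h f with Σ₁-Falling f
  ... | j , j≤ , Σ≡ = low {x} {y} h Σ≡
    (≤-trans (+-monoʳ-≤ 5 (+-monoˡ-≤ m j≤)) (+-monoˡ-≤ (m + m) (m≤n+m 6 4)))

  high-A : ∀ {x} → High x → x # labelA
  high-A {x} h = low {x} {labelA} h (Σ₁-A m) (+-mono-≤ (m≤n+m 5 5) (m≤m+n m m))

  high-B : ∀ {x} → High x → x # labelB
  high-B {x} h = low {x} {labelB} h (Σ₁-B m) (+-mono-≤ (m≤n+m 6 4) (m≤m+n m m))

  high-C : ∀ {x} → High x → x # labelC
  high-C {x} h = low {x} {labelC} h (Σ₁-C m) (+-monoˡ-≤ (m + m) (m≤n+m 8 2))

  ups downs : List Label
  ups   = rising 1 (1 + l)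
  downs = falling (2 + m) 1

  tail : List Label
  tail = labelC ∷ downs ++ labelA ∷ labelB ∷ []

  firstUp lastUp firstDown lastDown : Label
  firstUp   = ⟨ 2 , 1 , 1 + l , 0 ⟩
  lastUp    = ⟨ 2 + l , 1 + l , 1 , 0 ⟩
  firstDown = ⟨ 2 + m , l , 1 , 0 ⟩
  lastDown  = ⟨ 1 , 2 , 2 + m , 0 ⟩

  -- The cycle is read from the vertex after B through C and back to A and B; `cs` holds the labels
  -- of C before `labelC`. `firstUp ∷ rest cs` is definitionally `ups ++ cs ++ tail`.
  rest : List Label → List Label
  rest cs = rising 2 l ++ cs ++ tail

  length-family : ∀ cs → length (firstUp ∷ rest cs) ≡ 9 + length cs + (m + m)
  length-family cs = begin
    length (ups ++ cs ++ tail)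
      ≡⟨ length-++ ups ⟩
    length ups + length (cs ++ tail)
      ≡⟨ cong₂ _+_ (length-rising 1 (1 + l)) (length-++ cs) ⟩
    1 + l + (length cs + (1 + length (downs ++ labelA ∷ labelB ∷ [])))
      ≡⟨ cong (λ k → 1 + l + (length cs + (1 + k)))
              (trans (length-++ downs) (cong (_+ 2) (length-falling (2 + m) 1))) ⟩
    1 + l + (length cs + (1 + (2 + m + 2)))
      ≡⟨ count m (length cs) ⟩
    9 + length cs + (m + m) ∎
    where
    open ≡-Reasoning
    count : ∀ m k → 4 + m + (k + (1 + (2 + m + 2))) ≡ 9 + k + (m + m)
    count = solve-∀

  chain-ups : ∀ {c₀ c₁ c₃} → 1 + l ≤ c₀ → l ≤ c₁ → Chain Eikonalⱽ labelB ups ⟨ c₀ , c₁ , 0 , c₃ ⟩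
  chain-ups {c₀} {c₁} {c₃} 1+l≤c₀ l≤c₁ = chain-rising 0 (1 + l) {1 + l} {1} {c₀} {c₁} {c₃} (n≤1+n _)
    (≤-trans (≤-reflexive (+-identityʳ (1 + l))) 1+l≤c₀)
    (s≤s (≤-trans (≤-reflexive (+-identityʳ l)) l≤c₁))

  -- What both parities share: validity is reduced to conditions on the middle labels `c ∷ cs`.
  module _ (c : Label) (cs : List Label)
           (up : Chain Eikonalⱽ labelB ups c)
           (middle : Chain Eikonalⱽ lastUp (c ∷ cs) labelC)
           (end : Eikonalⱽ (lastOr c cs) labelC firstDown)
           (oneZero : All OneZero (c ∷ cs)) (distinct : AllPairs _#_ (c ∷ cs))
           (high : All High (c ∷ cs)) where

    family-last : lastOr firstUp (rest (c ∷ cs)) ≡ labelB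
    family-last = trans (lastOr-++ {a = firstUp} (rising 2 l) {(c ∷ cs) ++ tail})
      (trans (lastOr-++ {a = c} cs) (lastOr-++ {a = labelC} downs))

    family-chain : Chain Eikonalⱽ labelB (ups ++ (c ∷ cs) ++ tail) firstUp
    family-chain = chain-++ {a = labelB} ups up (subst (λ a → Chain Eikonalⱽ a ((c ∷ cs) ++ tail) firstUp)
      (sym (trans (lastOr-rising {labelB} 1 l) (cong (λ k → ⟨ suc k , k , 1 , 0 ⟩) (+-comm l 1))))
      (chain-++ {a = lastUp} (c ∷ cs) middle (end , down)))
      where
      closing : Chain Eikonalⱽ lastDown (labelA ∷ labelB ∷ []) firstUp
      closing = eikonal₄ (inj₁ refl) (inj₂ refl) (eikonalˡ (m≤n+m (2 + m) 2)) (inj₂ refl)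
              -- B takes its distance to C from A, as `firstUp` is itself at distance `1 + l` from
              -- C.
              , eikonal₄ (inj₂ refl) (inj₁ refl) (eikonalˡ (n≤1+n l)) (inj₂ refl)
              , tt
      down : Chain Eikonalⱽ labelC (downs ++ labelA ∷ labelB ∷ []) firstUp
      down = chain-++ {a = labelC} downs
        (chain-falling (2 + m) 0 {l} {1 + l} {1} {l} {1} (n≤1+n _) (n≤1+n _)
          (≤-trans (≤-reflexive (+-identityʳ (2 + m))) (m≤n+m _ 2)))
        (subst (λ a → Chain Eikonalⱽ a (labelA ∷ labelB ∷ []) firstUp)
          (sym (trans (lastOr-falling {labelC} (1 + m) 1)
                      (cong (λ k → ⟨ 1 , 2 , k , 0 ⟩) (+-comm (1 + m) 1)))) closing)

    family-oneZero : All OneZero (ups ++ (c ∷ cs) ++ tail)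
    family-oneZero = All.++⁺ (oneZero-rising 0 (1 + l)) (All.++⁺ oneZero
      (oneZero₂ ∷ All.++⁺ (oneZero-falling (2 + m) 0)
        (oneZero₀ ∷ oneZero₁ ∷ [])))

    family-# : AllPairs _#_ (ups ++ (c ∷ cs) ++ tail)
    family-# = AllPairs.++⁺ (rising-# 1 (1 + l))
      (AllPairs.++⁺ distinct
        (All.++⁺ (All.map C-falling fallings) (C-A ∷ C-B ∷ []) ∷
         AllPairs.++⁺ (falling-# (2 + m) 1) ((A-B ∷ []) ∷ [] ∷ [])
           (All.map (λ f → falling-A f ∷ falling-B f ∷ []) fallings))
        (All.map (λ {x} h → high-C {x} h ∷
          All.++⁺ (All.map (high-falling {x} h) fallings) (high-A {x} h ∷ high-B {x} h ∷ [])) high))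
      (All.map (λ r → All.++⁺ (All.map (λ {y} h → rising-high {y = y} r h) high)
        (rising-C r ∷ All.++⁺ (All.map (rising-falling r) fallings) (rising-A r ∷ rising-B r ∷ [])))
        (rising-form 0 (1 + l) refl))
      where
      fallings : All (Falling (1 + m)) downs
      fallings = falling-form (2 + m) 0 (+-identityʳ (2 + m))

    family-valid : Valid firstUp (rest (c ∷ cs))
    family-valid =
      subst (λ a → Chain Eikonalⱽ a (ups ++ (c ∷ cs) ++ tail) firstUp) (sym family-last) family-chain
      , family-oneZero , family-#

  -- Together with `labelC` these give C three vertices for n = 11 + 2m and four for n = 12 + 2m.
  oddMiddle evenMiddle : List Label
  oddMiddle  = ⟨ 2 + l , 2 + l , 0 , 1 ⟩ ∷ ⟨ 1 + l , 2 + l , 0 , 2 ⟩ ∷ []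
  evenMiddle = ⟨ 3 + l , 2 + l , 0 , 1 ⟩ ∷ ⟨ 2 + l , 3 + l , 0 , 2 ⟩ ∷ ⟨ 1 + l , 2 + l , 0 , 2 ⟩ ∷ []

  odd-valid : Valid firstUp (rest oddMiddle)
  odd-valid = family-valid ⟨ 2 + l , 2 + l , 0 , 1 ⟩ (⟨ 1 + l , 2 + l , 0 , 2 ⟩ ∷ [])
    (chain-ups {2 + l} {2 + l} {1} (n≤1+n _) (m≤n+m l 2))
    ( eikonal₄ (eikonalʳ (n≤1+n _)) (eikonalˡ (n≤1+n _)) (inj₁ refl) (inj₂ refl)
    , eikonal₄ (eikonalʳ (m≤n+m _ 2)) (eikonalʳ (n≤1+n _)) (inj₁ refl) (inj₂ refl)
    , tt)
    (eikonal₄ (eikonalʳ (m≤n+m _ 2)) (eikonalʳ (m≤n+m _ 2)) (inj₁ refl) (inj₂ refl))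
    (oneZero₂ ∷ oneZero₂ ∷ [])
    -- Both middle labels have sum 11 + 2m; their sums of squares differ by 6 + 2m.
    ((differ ∷ []) ∷ [] ∷ [])
    (≤-reflexive (sum₁ m) ∷ ≤-reflexive (sum₂ m) ∷ [])
    where
    squares : ∀ m →
      (5 + m) * (5 + m) + ((5 + m) * (5 + m) + (0 * 0 + (1 * 1 + 0))) ≡
      1 + ((4 + m) * (4 + m) + ((5 + m) * (5 + m) + (0 * 0 + (2 * 2 + 0))) + (5 + 2 * m))
    squares = solve-∀
    differ : ⟨ 2 + l , 2 + l , 0 , 1 ⟩ # ⟨ 1 + l , 2 + l , 0 , 2 ⟩
    differ eq = m≢1+m+n _ (trans (cong proj₂ (sym eq)) (squares m))
    sum₁ : ∀ m → 11 + (m + m) ≡ (5 + m) + ((5 + m) + (0 + (1 + 0)))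
    sum₁ = solve-∀
    sum₂ : ∀ m → 11 + (m + m) ≡ (4 + m) + ((5 + m) + (0 + (2 + 0)))
    sum₂ = solve-∀

  even-valid : Valid firstUp (rest evenMiddle)
  even-valid = family-valid ⟨ 3 + l , 2 + l , 0 , 1 ⟩
    (⟨ 2 + l , 3 + l , 0 , 2 ⟩ ∷ ⟨ 1 + l , 2 + l , 0 , 2 ⟩ ∷ [])
    (chain-ups {3 + l} {2 + l} {1} (m≤n+m _ 2) (m≤n+m l 2))
    ( eikonal₄ (eikonalˡ ≤-refl) (eikonalˡ (m≤n+m _ 2)) (inj₁ refl) (inj₂ refl)
    , eikonal₄ (eikonalʳ (m≤n+m _ 2)) (eikonalˡ ≤-refl) (inj₁ refl) (inj₂ refl)
    , eikonal₄ (eikonalʳ (m≤n+m _ 2)) (eikonalʳ (m≤n+m _ 2)) (inj₁ refl) (inj₂ refl)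
    , tt)
    (eikonal₄ (eikonalʳ (m≤n+m _ 2)) (eikonalʳ (m≤n+m _ 2)) (inj₁ refl) (inj₂ refl))
    (oneZero₂ ∷ oneZero₂ ∷ oneZero₂ ∷ [])
    ( (by-sum c₁ c₂ {1} {2} (sum₁ m) (sum₂ m) (λ ()) ∷ by-sum c₁ c₃ {1} {0} (sum₁ m) (sum₃ m) (λ ()) ∷ [])
    ∷ (by-sum c₂ c₃ {2} {0} (sum₂ m) (sum₃ m) (λ ()) ∷ [])
    ∷ [] ∷ [])
    (high c₁ {1} (sum₁ m) ∷ high c₂ {2} (sum₂ m) ∷ high c₃ {0} (sum₃ m) ∷ [])
    where
    c₁ c₂ c₃ : Label
    c₁ = ⟨ 3 + l , 2 + l , 0 , 1 ⟩
    c₂ = ⟨ 2 + l , 3 + l , 0 , 2 ⟩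
    c₃ = ⟨ 1 + l , 2 + l , 0 , 2 ⟩
    by-sum : ∀ (x y : Label) {j k} → Σ₁ x ≡ j + (11 + (m + m)) → Σ₁ y ≡ k + (11 + (m + m)) → j ≢ k → x # y
    by-sum x y p q j≢k = by-Σ₁ {x} {y} λ eq → j≢k (+-cancelʳ-≡ _ _ _ (trans (sym p) (trans eq q)))
    high : ∀ x {k} → Σ₁ x ≡ k + (11 + (m + m)) → High x
    high x {k} eq = ≤-trans (m≤n+m _ k) (≤-reflexive (sym eq))
    sum₁ : ∀ m → (6 + m) + ((5 + m) + (0 + (1 + 0))) ≡ 1 + (11 + (m + m))
    sum₁ = solve-∀
    sum₂ : ∀ m → (5 + m) + ((6 + m) + (0 + (2 + 0))) ≡ 2 + (11 + (m + m))
    sum₂ = solve-∀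
    sum₃ : ∀ m → (4 + m) + ((5 + m) + (0 + (2 + 0))) ≡ 0 + (11 + (m + m))
    sum₃ = solve-∀

  family-resolving : ∀ {n} (3≤n : 3 ≤ n) cs → 9 + length cs + (m + m) ≡ n → Valid firstUp (rest cs) →
                     HasResolving (cycle n 3≤n) (cycle-connected n 3≤n) 4
  family-resolving 3≤n cs eq = cycle-valid 3≤n firstUp (rest cs) (trans (length-family cs) eq)

-- The ranges of n

halve : ∀ n → ∃ λ m → m + m ≡ n ⊎ suc (m + m) ≡ n
halve zero = 0 , inj₁ refl
halve (suc n) with halve n
... | m , inj₁ eq = m , inj₂ (cong suc eq)
... | m , inj₂ eq = suc m , inj₁ (cong suc (trans (+-suc m m) eq))

resolving-≥9 : ∀ {n} (3≤n : 3 ≤ n) → 9 ≤ n → HasResolving (cycle n 3≤n) (cycle-connected n 3≤n) 4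
resolving-≥9 {n} 3≤n 9≤n = let k , eq = m≤n⇒∃[o]m+o≡n 9≤n in cases k eq
  where
  cases : ∀ k → 9 + k ≡ n → HasResolving (cycle n 3≤n) (cycle-connected n 3≤n) 4
  cases 0 = resolving₉ 3≤n
  cases 1 = resolving₁₀ 3≤n
  cases (suc (suc k)) eq with halve k
  ... | m , inj₁ 2m≡k   = family-resolving 3≤n oddMiddle (trans (cong (11 +_) 2m≡k) eq) odd-valid
    where open Family m
  ... | m , inj₂ 1+2m≡k = family-resolving 3≤n evenMiddle (trans (cong (11 +_) 1+2m≡k) eq) even-valid
    where open Family m

-- `U?` admits every number of parts, so one search for each n covers all set partitions.
¬resolving-≤7 : ∀ n (3≤n : 3 ≤ n) → n ≤ 7 → ∀ t → ¬ HasResolving (cycle n 3≤n) (cycle-connected n 3≤n) t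
¬resolving-≤7 3 3≤n _ t = refute-cycle 3≤n U? {tt} {tt} tt
¬resolving-≤7 4 3≤n _ t = refute-cycle 3≤n U? {tt} {tt} tt
¬resolving-≤7 5 3≤n _ t = refute-cycle 3≤n U? {tt} {tt} tt
¬resolving-≤7 6 3≤n _ t = refute-cycle 3≤n U? {tt} {tt} tt
¬resolving-≤7 7 3≤n _ t = refute-cycle 3≤n U? {tt} {tt} tt
¬resolving-≤7 1 (s≤s ()) _ t
¬resolving-≤7 2 (s≤s (s≤s ())) _ t
¬resolving-≤7 (suc (suc (suc (suc (suc (suc (suc (suc _)))))))) _
  (s≤s (s≤s (s≤s (s≤s (s≤s (s≤s (s≤s ()))))))) t

resolving⇒4≤ : ∀ n (3≤n : 3 ≤ n) t → HasResolving (cycle n 3≤n) (cycle-connected n 3≤n) t → 4 ≤ t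
resolving⇒4≤ n@(suc (suc _)) 3≤n 0 r = ⊥-elim (¬resolving₀ (cycle n 3≤n) (cycle-connected n 3≤n) zero r)
resolving⇒4≤ n@(suc (suc _)) 3≤n 1 r = ⊥-elim (¬resolving₁ (cycle n 3≤n) (cycle-connected n 3≤n) {zero} {suc zero} (λ ()) r)
resolving⇒4≤ n@(suc (suc _)) 3≤n 2 r = ⊥-elim (¬resolving₂ (cycle n 3≤n) (cycle-connected n 3≤n) r)
resolving⇒4≤ n@(suc (suc _)) 3≤n 3 r = ⊥-elim (¬resolving₃ (cycle n 3≤n) (cycle-connected n 3≤n) r)
resolving⇒4≤ n@(suc (suc _)) 3≤n (suc (suc (suc (suc _)))) _ = s≤s (s≤s (s≤s (s≤s z≤n)))
resolving⇒4≤ 1 (s≤s ())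

-- Only leaves with exactly four parts are refuted, since five parts do resolve; fewer are excluded
-- by the general bound.
resolving₈⇒5≤ : ∀ (3≤8 : 3 ≤ 8) t → HasResolving (cycle 8 3≤8) (cycle-connected 8 3≤8) t → 5 ≤ t
resolving₈⇒5≤ 3≤8 t r = ≤∧≢⇒< (resolving⇒4≤ 8 3≤8 t r)
  λ 4≡t → refute-cycle 3≤8 (_≟ 4) {tt} {tt} (sym 4≡t) r

theorem3p2 : (n : ℕ) (3≤n : 3 ≤ n) →
    (n ≤ 7 → IsMpd (cycle n 3≤n) (cycle-connected n 3≤n) ⊤⁺)
    × (n ≡ 8 → IsMpd (cycle n 3≤n) (cycle-connected n 3≤n) [ 5 ])
    × (9 ≤ n → IsMpd (cycle n 3≤n) (cycle-connected n 3≤n) [ 4 ])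
theorem3p2 n 3≤n = ¬resolving-≤7 n 3≤n
                 , (λ { refl → resolving₈ 3≤n refl , resolving₈⇒5≤ 3≤n })
                 , (λ 9≤n → resolving-≥9 3≤n 9≤n , resolving⇒4≤ n 3≤n)
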